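{- Let $k\ge2$. For every $\delta>0$ there is $n_0$ such that for every $n\ge n_0$ divisible by $k$, every red/blue-coloring of $E(K_n)$ contains a $K_k$-factor with at least $(\lambda_k-\delta)n$ edges of the same color.
   Context: A $K_k$-factor of $K_n$ ($k\mid n$) is a collection of $n/k$ vertex-disjoint copies of $K_k$ covering all vertices; its edges are the edges of these cliques. The bipartite construction with ratio $\rho\in[0,1]$ is the red/blue-coloring of $K_n$ obtained by partitioning $V(K_n)=X\cup Y$ with $|X|=\rho n$, coloring all edges touching $X$ with one color and all edges inside $Y$ with the other color. For $k\ge2$, $\lambda_k$ is the supremum of all $\lambda$ such that for every $n$ divisible by $k$ and every $\rho\in[0,1]$ (with $\rho n$ an integer), the $n$-vertex bipartite construction with ratio $\rho$ has a $K_k$-factor with at least $\lambda n$ edges of the same color. -}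

module Defs where

open import Data.Bool using (if_then_else_; _∨_)
open import Data.Bool.Properties using (∨-comm)
open import Data.Fin using (Fin; _<?_)
open import Data.Fin.Subset using (Subset; _∈_; _∩_; Empty) renaming (∣_∣ to card)
open import Data.Fin.Subset.Properties using (_∈?_)
open import Data.Integer using (+_)
open import Data.List using (List; length; filter; concatMap; allFin; cartesianProduct)
open import Data.List.Relation.Unary.All using (All)
open import Data.List.Relation.Unary.Any using (Any)
open import Data.List.Relation.Unary.AllPairs using (AllPairs)
open import Data.Nat using (ℕ; zero; suc) renaming (_*_ to _*ℕ_; _≤_ to _≤ℕ_; _⊔_ to _⊔ℕ_)
open import Data.Nat.Divisibility using (_∣_)
import Data.Nat.Properties as ℕ
open import Data.Product using (Σ; ∃-syntax; _×_; _,_)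
open import Data.Rational using (ℚ; 0ℚ; 1ℚ; ½; _+_; _-_; _*_; -_; ∣_∣; _≤_; _<_; _/_)
import Data.Rational.Properties as ℚ
open import Data.Vec using (lookup)
open import Relation.Binary.Definitions using (DecidableEquality)
open import Relation.Binary.PropositionalEquality
  using (module ≡-Reasoning; _≡_; refl; sym; trans; cong; subst)
open import Relation.Nullary using (yes; no)
open import Relation.Nullary.Decidable using (_×-dec_)

-- Cauchy sequences of rationals; two sequences denote the same real when
-- each is ≤ᴿ the other.
record ℝ : Set where
  constructor mkℝ
  field
    seq    : ℕ → ℚ
    cauchy : ∀ ε → 0ℚ < ε →
             ∃[ N ] (∀ m n → N ≤ℕ m → N ≤ℕ n → ∣ seq m - seq n ∣ < ε)

open ℝ public

infix 4 _≤ᴿ_ _<ᴿ_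

_≤ᴿ_ : ℝ → ℝ → Set
x ≤ᴿ y = ∀ ε → 0ℚ < ε → ∃[ N ] (∀ m → N ≤ℕ m → seq x m ≤ seq y m + ε)

_<ᴿ_ : ℝ → ℝ → Set
x <ᴿ y = ∃[ ε ] (0ℚ < ε × ∃[ N ] (∀ m → N ≤ℕ m → seq x m + ε ≤ seq y m))

fromℚ : ℚ → ℝ
fromℚ q = mkℝ (λ _ → q) λ ε 0<ε →
  0 , λ _ _ _ _ → subst (λ r → ∣ r ∣ < ε) (sym (ℚ.+-inverseʳ q)) 0<ε

natℚ : ℕ → ℚ
natℚ n = + n / 1

fromℕ : ℕ → ℝ
fromℕ n = fromℚ (natℚ n)

0ᴿ : ℝ
0ᴿ = fromℚ 0ℚ

private
  0<ε/2 : ∀ {ε} → 0ℚ < ε → 0ℚ < ½ * ε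
  0<ε/2 {ε} 0<ε = subst (_< ½ * ε) (ℚ.*-zeroʳ ½) (ℚ.*-monoʳ-<-pos ½ 0<ε)

  halves : ∀ ε → ½ * ε + ½ * ε ≡ ε
  halves ε = trans (sym (ℚ.*-distribʳ-+ ε ½ ½)) (ℚ.*-identityˡ ε)

  interchange : ∀ a b c d → (a + b) - (c + d) ≡ (a - c) + (b - d)
  interchange a b c d = begin
    (a + b) + - (c + d)      ≡⟨ cong (_+_ (a + b)) (ℚ.neg-distrib-+ c d) ⟩
    (a + b) + (- c + - d)    ≡⟨ ℚ.+-assoc a b (- c + - d) ⟩
    a + (b + (- c + - d))    ≡⟨ cong (_+_ a) (sym (ℚ.+-assoc b (- c) (- d))) ⟩
    a + ((b + - c) + - d)    ≡⟨ cong (λ t → a + (t + - d)) (ℚ.+-comm b (- c)) ⟩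
    a + ((- c + b) + - d)    ≡⟨ cong (_+_ a) (ℚ.+-assoc (- c) b (- d)) ⟩
    a + (- c + (b + - d))    ≡⟨ sym (ℚ.+-assoc a (- c) (b + - d)) ⟩
    (a + - c) + (b + - d)    ∎
    where open ≡-Reasoning

infixl 6 _+ᴿ_ _-ᴿ_
infix  8 -ᴿ_
infixl 7 _·_

_+ᴿ_ : ℝ → ℝ → ℝ
x +ᴿ y = mkℝ (λ m → seq x m + seq y m) λ ε 0<ε →
  let M , p = cauchy x (½ * ε) (0<ε/2 0<ε)
      N , q = cauchy y (½ * ε) (0<ε/2 0<ε)
  in M ⊔ℕ N , λ m n m≥ n≥ →
       subst (λ r → ∣ r ∣ < ε) (sym (interchange (seq x m) (seq y m) (seq x n) (seq y n)))
         (ℚ.≤-<-trans (ℚ.∣p+q∣≤∣p∣+∣q∣ (seq x m - seq x n) (seq y m - seq y n))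
           (subst (_<_ _) (halves ε)
             (ℚ.+-mono-< (p m n (ℕ.m⊔n≤o⇒m≤o M N m≥) (ℕ.m⊔n≤o⇒m≤o M N n≥))
                         (q m n (ℕ.m⊔n≤o⇒n≤o M N m≥) (ℕ.m⊔n≤o⇒n≤o M N n≥)))))

-ᴿ_ : ℝ → ℝ
-ᴿ x = mkℝ (λ m → - seq x m) λ ε 0<ε →
  let N , p = cauchy x ε 0<ε
  in N , λ m n m≥ n≥ →
       subst (_< ε)
         (trans (sym (ℚ.∣-p∣≡∣p∣ (seq x m - seq x n)))
                (cong ∣_∣ (ℚ.neg-distrib-+ (seq x m) (- seq x n))))
         (p m n m≥ n≥)

_-ᴿ_ : ℝ → ℝ → ℝ
x -ᴿ y = x +ᴿ (-ᴿ y)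

-- The only products needed are those of a real with a natural number.
_·_ : ℕ → ℝ → ℝ
zero  · x = 0ᴿ
suc n · x = x +ᴿ n · x

record IsSupremum (P : ℝ → Set) (s : ℝ) : Set where
  field
    upperBound : ∀ x → P x → x ≤ᴿ s
    least      : ∀ b → (∀ x → P x → x ≤ᴿ b) → s ≤ᴿ b

data Colour : Set where
  red blue : Colour

opposite : Colour → Colour
opposite red  = blue
opposite blue = red

_≟ᶜ_ : DecidableEquality Colour
red  ≟ᶜ red  = yes refl
red  ≟ᶜ blue = no λ ()
blue ≟ᶜ red  = no λ ()
blue ≟ᶜ blue = yes refl

-- A colouring of the edges of the complete graph on Fin n. The values on the
-- diagonal are never used.
record Colouring (n : ℕ) : Set where
  field
    colour    : Fin n → Fin n → Colour
    symmetric : ∀ u v → colour u v ≡ colour v u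

open Colouring public

-- A copy of K_k inside K_n is determined by its vertex set.
record Factor (k n : ℕ) : Set where
  field
    cliques  : List (Subset n)
    number   : length cliques *ℕ k ≡ n
    size     : All (λ S → card S ≡ k) cliques
    disjoint : AllPairs (λ S T → Empty (S ∩ T)) cliques
    covering : ∀ v → Any (λ S → v ∈ S) cliques

open Factor public

-- Each edge {u , v} is listed once, as the pair with u < v.
cliqueEdges : ∀ {n} → Subset n → List (Fin n × Fin n)
cliqueEdges {n} S =
  filter (λ (u , v) → (u <? v) ×-dec (u ∈? S) ×-dec (v ∈? S))
         (cartesianProduct (allFin n) (allFin n))

edges : ∀ {k n} → Factor k n → List (Fin n × Fin n)
edges F = concatMap cliqueEdges (cliques F)

edgesOfColour : ∀ {k n} → Colouring n → Colour → Factor k n → ℕ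
edgesOfColour c a F = length (filter (λ (u , v) → colour c u v ≟ᶜ a) (edges F))

HasFactor : ∀ {n} → ℕ → Colouring n → ℝ → Set
HasFactor {n} k c t =
  Σ (Factor k n) λ F → ∃[ a ] (t ≤ᴿ fromℕ (edgesOfColour c a F))

-- The edges touching X get colour a; Y is the complement of X.
bipartite : ∀ {n} → Subset n → Colour → Colouring n
bipartite X a = record
  { colour    = λ u v → if lookup X u ∨ lookup X v then a else opposite a
  ; symmetric = λ u v → cong (if_then a else opposite a)
                             (∨-comm (lookup X u) (lookup X v))
  }

-- A ratio ρ with ρ n an integer is rational, so ρ ranges over ℚ.
Admissible : ℕ → ℝ → Set
Admissible k λ′ =
  ∀ n → k ∣ n → ∀ ρ → 0ℚ ≤ ρ → ρ ≤ 1ℚ →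
  ∀ (X : Subset n) → natℚ (card X) ≡ ρ * natℚ n →
  ∀ a → HasFactor k (bipartite X a) (n · λ′)

-- λ_k is the supremum of a nonempty set of reals bounded above by (k - 1) / 2.
IsLambda : ℕ → ℝ → Set
IsLambda k = IsSupremum (Admissible k)

{-# OPTIONS --safe #-}
module Submission where

-- Call a K_k-factor mixed if its cliques meet a red clique R and a blue clique
-- B in almost constant proportion, and pure if they lie in R or in B. In the
-- bipartite construction a mixed factor is optimal for the colour of X and a
-- pure one for the other colour, and at a critical ratio x = s / (s + l) < 1/2
-- both attain the same density, which bounds λ_k from above.
--
-- In an arbitrary colouring, Ramsey's theorem covers almost everything by large
-- monochromatic cliques, and its bipartite version cuts pairs of a red and a
-- blue clique into tiles with sides in ratio x : 1 - x that are joined in a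
-- single colour. The gain of mixed over pure cliques is j(k - j)/2 for parts of
-- sizes j and k - j, whichever colour the joining edges have; by this symmetry
-- the best red and the best blue packing of a tile always have together twice
-- the critical number of edges, and the colour of the larger side attains it
-- alone. Tiles are removed with the larger side in the more frequent colour: either
-- this colour never changes, and it wins, or the colours become balanced and
-- the tiles use up nearly all vertices, and the better of the two colours wins.
open import Defs
open import Data.Bool using (true; false)
open import Data.Empty using (⊥-elim)
open import Data.Fin using (Fin; zero; suc)
import Data.Fin.Properties as Fin
open import Data.Fin.Subset using (Subset; inside; ⁅_⁆; _∪_)
  renaming (_∈_ to _∈ˢ_; ∣_∣ to card; ⊥ to ∅)
open import Data.Fin.Subset.Properties
  using (_∈?_; x∈⁅x⁆; x∈⁅y⁆⇒x≡y; x∈p∪q⁺; x∈p∪q⁻; x∈p∩q⁺; x∈p∩q⁻; ∉⊥; ∣⊥∣≡0)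
import Data.Integer as ℤ
import Data.Integer.Properties as ℤ
import Data.Integer.Tactic.RingSolver as ℤ
open import Data.List using (List; []; _∷_; _++_; map; concat; filter; length; allFin; cartesianProduct)
open import Data.List.Membership.Propositional using (_∈_; find)
open import Data.List.Membership.Propositional.Properties
  using (∈-filter⁺; ∈-filter⁻; ∈-allFin; ∈-concat⁺′; ∈-map⁺; ∈-map⁻; ∈-++⁻)
open import Data.List.Membership.Propositional.Properties.WithK using (unique∧set⇒bag)
open import Data.List.Properties
  using (map-tabulate; length-++; length-map; length-tabulate; ++-assoc; ++-identityʳ; concat-++)
open import Data.List.Relation.Binary.BagAndSetEquality using (∼bag⇒↭)
open import Data.List.Relation.Binary.Permutation.Propositional
  using (_↭_; ↭-refl; ↭-reflexive; ↭-prep; ↭-sym; ↭-trans)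
open import Data.List.Relation.Binary.Permutation.Propositional.Properties as ↭
  using (↭-length; ∈-resp-↭; All-resp-↭)
open import Data.List.Relation.Unary.All as All using (All; []; _∷_)
import Data.List.Relation.Unary.All.Properties as All
open import Data.List.Relation.Unary.AllPairs as AllPairs using (AllPairs; []; _∷_)
import Data.List.Relation.Unary.AllPairs.Properties as AllPairs
open import Data.List.Relation.Unary.Any using (Any; here; there)
open import Data.List.Relation.Unary.Unique.Propositional using (Unique)
import Data.List.Relation.Unary.Unique.Propositional.Properties as Unique
open import Data.Nat
  using (ℕ; zero; suc; _+_; _*_; _∸_; _^_; _/_; _%_; _⊔_; _≤_; _<_; z≤n; s≤s; s≤s⁻¹; NonZero; >-nonZero)
open import Data.Nat.Divisibility using (_∣_; divides)
open import Data.Nat.DivMod using (m≡m%n+[m/n]*n; m%n≤n)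
open import Data.Nat.ListAction using (sum)
open import Data.Nat.ListAction.Properties using (sum-↭)
open import Data.Nat.Properties
open import Data.Nat.Tactic.RingSolver using (solve-∀)
open import Data.Product using (∃-syntax; _×_; _,_; proj₁; proj₂)
open import Data.Rational as ℚ using (ℚ; mkℚ; 0ℚ; 1ℚ; ½)
import Data.Rational.Properties as ℚ
open import Data.Rational.Solver using (module +-*-Solver)
import Data.Rational.Unnormalised as ℚᵘ
import Data.Rational.Unnormalised.Properties as ℚᵘ
open import Data.Sum using (_⊎_; inj₁; inj₂)
open import Data.Vec as Vec using (lookup; here; there)
open import Data.Vec.Properties using (lookup⇒[]=; []=⇒lookup)
open import Function using (_∘_; id)
open import Function.Bundles using (mk⇔)
open import Relation.Binary.Definitions using (tri<; tri≈; tri>)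
open import Relation.Binary.PropositionalEquality
open import Relation.Nullary using (Dec; yes; no; ¬_)
open import Relation.Nullary.Decidable using (_×-dec_; ¬?)
open import Relation.Unary using (Decidable)

-- Counting edges by sums over lists

-- Linear arithmetic: to get a ≤ b from x ≤ y it suffices that a - b = x - y.
linear : ∀ {x y a b} → x ≤ y → a + y ≡ b + x → a ≤ b
linear {x} {y} {a} {b} x≤y eq =
  +-cancelʳ-≤ x a b (≤-trans (+-monoʳ-≤ a x≤y) (≤-reflexive eq))

∑ : ∀ {A : Set} → (A → ℕ) → List A → ℕ
∑ f xs = sum (map f xs)

χ : ∀ {P : Set} → Dec P → ℕ
χ (yes _) = 1
χ (no  _) = 0

χ-yes : ∀ {P : Set} (d : Dec P) → P → χ d ≡ 1
χ-yes (yes _) p = refl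
χ-yes (no ¬p) p = ⊥-elim (¬p p)

χ-no : ∀ {P : Set} (d : Dec P) → ¬ P → χ d ≡ 0
χ-no (yes p) ¬p = ⊥-elim (¬p p)
χ-no (no _)  ¬p = refl

χ-⇔ : ∀ {P Q : Set} (d : Dec P) (d′ : Dec Q) → (P → Q) → (Q → P) → χ d ≡ χ d′
χ-⇔ (yes p) d′ f g = sym (χ-yes d′ (f p))
χ-⇔ (no ¬p) d′ f g = sym (χ-no d′ (¬p ∘ g))

χ-× : ∀ {P Q : Set} (d : Dec P) (d′ : Dec Q) → χ (d ×-dec d′) ≡ χ d * χ d′
χ-× (yes p) (yes q) = refl
χ-× (yes p) (no ¬q) = refl
χ-× (no ¬p) d′      = refl

module _ {A : Set} where

  ∑-cong : ∀ {f g : A → ℕ} xs → (∀ x → x ∈ xs → f x ≡ g x) → ∑ f xs ≡ ∑ g xs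
  ∑-cong []       f≗g = refl
  ∑-cong (x ∷ xs) f≗g = cong₂ _+_ (f≗g x (here refl)) (∑-cong xs λ y y∈ → f≗g y (there y∈))

  ∑-mono : ∀ {f g : A → ℕ} xs → (∀ x → x ∈ xs → f x ≤ g x) → ∑ f xs ≤ ∑ g xs
  ∑-mono []       f≤g = z≤n
  ∑-mono (x ∷ xs) f≤g = +-mono-≤ (f≤g x (here refl)) (∑-mono xs λ y y∈ → f≤g y (there y∈))

  ∑-++ : ∀ (f : A → ℕ) xs ys → ∑ f (xs ++ ys) ≡ ∑ f xs + ∑ f ys
  ∑-++ f []       ys = refl
  ∑-++ f (x ∷ xs) ys = trans (cong (f x +_) (∑-++ f xs ys)) (sym (+-assoc (f x) _ _))

  ∑-concat : ∀ (f : A → ℕ) xss → ∑ f (concat xss) ≡ ∑ (∑ f) xss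
  ∑-concat f []         = refl
  ∑-concat f (xs ∷ xss) = trans (∑-++ f xs (concat xss)) (cong (∑ f xs +_) (∑-concat f xss))

  ∑-↭ : ∀ (f : A → ℕ) {xs ys} → xs ↭ ys → ∑ f xs ≡ ∑ f ys
  ∑-↭ f p = sum-↭ (↭.map⁺ f p)

  ∑-+ : ∀ (f g : A → ℕ) xs → ∑ (λ x → f x + g x) xs ≡ ∑ f xs + ∑ g xs
  ∑-+ f g []       = refl
  ∑-+ f g (x ∷ xs) = trans (cong (f x + g x +_) (∑-+ f g xs)) (interchange (f x) (g x) (∑ f xs) (∑ g xs))
    where
    interchange : ∀ a b c d → a + b + (c + d) ≡ a + c + (b + d)
    interchange = solve-∀

  ∑-*ˡ : ∀ m (f : A → ℕ) xs → ∑ (λ x → m * f x) xs ≡ m * ∑ f xs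
  ∑-*ˡ m f []       = sym (*-zeroʳ m)
  ∑-*ˡ m f (x ∷ xs) = trans (cong (m * f x +_) (∑-*ˡ m f xs)) (sym (*-distribˡ-+ m (f x) (∑ f xs)))

  ∑-const : ∀ m (xs : List A) → ∑ (λ _ → m) xs ≡ length xs * m
  ∑-const m []       = refl
  ∑-const m (x ∷ xs) = cong (m +_) (∑-const m xs)

  length-filter : ∀ {P : (A → Set)} (P? : Decidable P) xs → length (filter P? xs) ≡ ∑ (λ x → χ (P? x)) xs
  length-filter P? []       = refl
  length-filter P? (x ∷ xs) with P? x
  ... | yes _ = cong suc (length-filter P? xs)
  ... | no  _ = length-filter P? xs

  ∑-filter : ∀ {P : (A → Set)} (P? : Decidable P) (f : A → ℕ) xs →
             ∑ f (filter P? xs) ≡ ∑ (λ x → χ (P? x) * f x) xs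
  ∑-filter P? f []       = refl
  ∑-filter P? f (x ∷ xs) with P? x
  ... | yes _ = cong₂ _+_ (sym (+-identityʳ (f x))) (∑-filter P? f xs)
  ... | no  _ = ∑-filter P? f xs

∑-map : ∀ {A B : Set} (f : B → ℕ) (g : A → B) xs → ∑ f (map g xs) ≡ ∑ (f ∘ g) xs
∑-map f g []       = refl
∑-map f g (x ∷ xs) = cong (f (g x) +_) (∑-map f g xs)

∑-cartesianProduct : ∀ {A B : Set} (f : A × B → ℕ) xs ys →
  ∑ f (cartesianProduct xs ys) ≡ ∑ (λ x → ∑ (λ y → f (x , y)) ys) xs
∑-cartesianProduct f []       ys = refl
∑-cartesianProduct f (x ∷ xs) ys =
  trans (∑-++ f (map (x ,_) ys) (cartesianProduct xs ys))
        (cong₂ _+_ (∑-map f (x ,_) ys) (∑-cartesianProduct f xs ys))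

-- Peeling off the first row and column pairs `(x , v)` with `(v , x)`: the induction step from
-- ordered to unordered pairs.
∑∑-swap-head : ∀ {A : Set} (g : A → A → ℕ) x xs →
  ∑ (λ u → ∑ (g u) (x ∷ xs)) (x ∷ xs) ≡
  g x x + ∑ (λ v → g x v + g v x) xs + ∑ (λ u → ∑ (g u) xs) xs
∑∑-swap-head g x xs = begin
  g x x + ∑ (g x) xs + ∑ (λ u → g u x + ∑ (g u) xs) xs
    ≡⟨ cong (g x x + ∑ (g x) xs +_) (∑-+ (λ u → g u x) (λ u → ∑ (g u) xs) xs) ⟩
  g x x + ∑ (g x) xs + (∑ (λ u → g u x) xs + T)
    ≡⟨ reassoc (g x x) (∑ (g x) xs) (∑ (λ u → g u x) xs) T ⟩
  g x x + (∑ (g x) xs + ∑ (λ u → g u x) xs) + T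
    ≡⟨ cong (λ t → g x x + t + T) (sym (∑-+ (g x) (λ u → g u x) xs)) ⟩
  g x x + ∑ (λ v → g x v + g v x) xs + T ∎
  where
  open ≡-Reasoning
  T = ∑ (λ u → ∑ (g u) xs) xs
  reassoc : ∀ a b c d → a + b + (c + d) ≡ a + (b + c) + d
  reassoc = solve-∀

elements : ∀ {n} → Subset n → List (Fin n)
elements {n} S = filter (_∈? S) (allFin n)

fromList : ∀ {n} → List (Fin n) → Subset n
fromList []       = ∅
fromList (x ∷ xs) = ⁅ x ⁆ ∪ fromList xs

module _ {n : ℕ} where

  ∈-elements⁺ : ∀ {v} {S : Subset n} → v ∈ˢ S → v ∈ elements S
  ∈-elements⁺ {v} v∈S = ∈-filter⁺ (_∈? _) (∈-allFin v) v∈S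

  ∈-elements⁻ : ∀ {v} {S : Subset n} → v ∈ elements S → v ∈ˢ S
  ∈-elements⁻ {v} {S} v∈ = proj₂ (∈-filter⁻ (_∈? S) {xs = allFin n} v∈)

  elements-unique : (S : Subset n) → Unique (elements S)
  elements-unique S = Unique.filter⁺ (_∈? S) (Unique.allFin⁺ n)

  ∈-fromList⁺ : ∀ {v} {xs : List (Fin n)} → v ∈ xs → v ∈ˢ fromList xs
  ∈-fromList⁺ (here refl) = x∈p∪q⁺ (inj₁ (x∈⁅x⁆ _))
  ∈-fromList⁺ (there v∈)  = x∈p∪q⁺ (inj₂ (∈-fromList⁺ v∈))

  ∈-fromList⁻ : ∀ {v} (xs : List (Fin n)) → v ∈ˢ fromList xs → v ∈ xs
  ∈-fromList⁻ []       v∈ = ⊥-elim (∉⊥ v∈)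
  ∈-fromList⁻ (x ∷ xs) v∈ with x∈p∪q⁻ ⁅ x ⁆ (fromList xs) v∈
  ... | inj₁ v∈x  = here (x∈⁅y⁆⇒x≡y x v∈x)
  ... | inj₂ v∈xs = there (∈-fromList⁻ xs v∈xs)

  unique-sets-↭ : ∀ {xs ys : List (Fin n)} → Unique xs → Unique ys →
                  (∀ {v} → v ∈ xs → v ∈ ys) → (∀ {v} → v ∈ ys → v ∈ xs) → xs ↭ ys
  unique-sets-↭ xs! ys! to from = ∼bag⇒↭ (unique∧set⇒bag xs! ys! (mk⇔ to from))

  elements-fromList : ∀ {xs : List (Fin n)} → Unique xs → elements (fromList xs) ↭ xs
  elements-fromList {xs} xs! = unique-sets-↭ (elements-unique (fromList xs)) xs!
    (λ v∈ → ∈-fromList⁻ xs (∈-elements⁻ v∈)) (λ v∈ → ∈-elements⁺ (∈-fromList⁺ v∈))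

∑-allFin : ∀ {n} (f : Fin (suc n) → ℕ) → ∑ f (allFin (suc n)) ≡ f zero + ∑ (f ∘ suc) (allFin n)
∑-allFin {n} f = cong (λ xs → f zero + sum xs)
  (trans (map-tabulate suc f) (sym (map-tabulate id (f ∘ suc))))

card-∑ : ∀ {n} (S : Subset n) → card S ≡ ∑ (λ v → χ (v ∈? S)) (allFin n)
card-∑ Vec.[] = refl
card-∑ (s Vec.∷ S) = trans (head s) (trans (cong (χ (zero ∈? (s Vec.∷ S)) +_) tail)
                                          (sym (∑-allFin (λ v → χ (v ∈? (s Vec.∷ S))))))
  where
  head : ∀ s → card (s Vec.∷ S) ≡ χ (zero ∈? (s Vec.∷ S)) + card S
  head true  = refl
  head false = refl
  tail : card S ≡ ∑ (λ v → χ (suc v ∈? (s Vec.∷ S))) (allFin _)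
  tail = trans (card-∑ S) (∑-cong (allFin _) λ v _ →
    χ-⇔ (v ∈? S) (suc v ∈? (s Vec.∷ S)) there λ { (there p) → p })

card-elements : ∀ {n} (S : Subset n) → card S ≡ length (elements S)
card-elements {n} S = trans (card-∑ S) (sym (length-filter (_∈? S) (allFin n)))

module Counting {n : ℕ} (c : Colouring n) where

  has : Colour → Fin n → Fin n → ℕ
  has a u v = χ (colour c u v ≟ᶜ a)

  has-sym : ∀ a u v → has a u v ≡ has a v u
  has-sym a u v = cong (λ b → χ (b ≟ᶜ a)) (symmetric c u v)

  degree : Colour → Fin n → List (Fin n) → ℕ
  degree a x ys = ∑ (has a x) ys

  -- Pairs are oriented by list order and not by the order of `Fin n`, so that the count recurses
  -- along the list; `edgeCount-↭` makes the order immaterial.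
  edgeCount : Colour → List (Fin n) → ℕ
  edgeCount a []       = 0
  edgeCount a (x ∷ xs) = degree a x xs + edgeCount a xs

  forward : Colour → Fin n → Fin n → ℕ
  forward a u v = χ (u Fin.<? v) * has a u v

  forward-total : ∀ a {u v} → u ≢ v → forward a u v + forward a v u ≡ has a u v
  forward-total a {u} {v} u≢v with Fin.<-cmp u v
  ... | tri< u<v _ v≮u = trans (cong₂ (λ s t → s * has a u v + t * has a v u)
                                      (χ-yes (u Fin.<? v) u<v) (χ-no (v Fin.<? u) v≮u))
                               (trans (+-identityʳ _) (+-identityʳ _))
  ... | tri≈ _ u≡v _   = ⊥-elim (u≢v u≡v)
  ... | tri> u≮v _ v<u = trans (cong₂ (λ s t → s * has a u v + t * has a v u)
                                      (χ-no (u Fin.<? v) u≮v) (χ-yes (v Fin.<? u) v<u))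
                               (trans (+-identityʳ _) (has-sym a v u))

  ∑∑-forward : ∀ a {xs} → Unique xs → ∑ (λ u → ∑ (forward a u) xs) xs ≡ edgeCount a xs
  ∑∑-forward a []                 = refl
  ∑∑-forward a {x ∷ xs} (x∉ ∷ xs!) = trans (∑∑-swap-head (forward a) x xs)
    (cong₂ _+_
      (cong₂ _+_
        (cong (_* has a x x) (χ-no (x Fin.<? x) (Fin.<-irrefl refl)))
        (∑-cong xs λ v v∈ → forward-total a (All.lookup x∉ v∈)))
      (∑∑-forward a xs!))

  ∑∑-forward-↭ : ∀ a {xs ys} → xs ↭ ys →
    ∑ (λ u → ∑ (forward a u) xs) xs ≡ ∑ (λ u → ∑ (forward a u) ys) ys
  ∑∑-forward-↭ a {xs} p =
    trans (∑-cong xs λ u _ → ∑-↭ (forward a u) p) (∑-↭ _ p)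

  edgeCount-↭ : ∀ a {xs ys} → Unique xs → Unique ys → xs ↭ ys → edgeCount a xs ≡ edgeCount a ys
  edgeCount-↭ a xs! ys! p =
    trans (sym (∑∑-forward a xs!)) (trans (∑∑-forward-↭ a p) (∑∑-forward a ys!))

  cliqueEdges-count : ∀ a (S : Subset n) →
    ∑ (λ (u , v) → has a u v) (cliqueEdges S) ≡ edgeCount a (elements S)
  cliqueEdges-count a S = begin
    ∑ f (cliqueEdges S)
      ≡⟨ ∑-filter P? f (cartesianProduct V V) ⟩
    ∑ (λ p → χ (P? p) * f p) (cartesianProduct V V)
      ≡⟨ ∑-cartesianProduct (λ p → χ (P? p) * f p) V V ⟩
    ∑ (λ u → ∑ (λ v → χ (P? (u , v)) * has a u v) V) V
      ≡⟨ ∑-cong V (λ u _ → trans (∑-cong V λ v _ → rearrange u v)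
           (trans (∑-*ˡ (χ (u ∈? S)) _ V)
                  (cong (χ (u ∈? S) *_) (sym (∑-filter (_∈? S) (forward a u) V))))) ⟩
    ∑ (λ u → χ (u ∈? S) * ∑ (forward a u) (elements S)) V
      ≡⟨ sym (∑-filter (_∈? S) _ V) ⟩
    ∑ (λ u → ∑ (forward a u) (elements S)) (elements S)
      ≡⟨ ∑∑-forward a (elements-unique S) ⟩
    edgeCount a (elements S) ∎
    where
    open ≡-Reasoning
    V = allFin n
    f : Fin n × Fin n → ℕ
    f (u , v) = has a u v
    P? : ∀ p → Dec _
    P? = λ (u , v) → (u Fin.<? v) ×-dec (u ∈? S) ×-dec (v ∈? S)
    ring : ∀ x y z t → x * (y * z) * t ≡ y * (z * (x * t))
    ring = solve-∀
    rearrange : ∀ u v → χ (P? (u , v)) * has a u v ≡ χ (u ∈? S) * (χ (v ∈? S) * forward a u v)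
    rearrange u v = trans
      (cong (_* has a u v) (trans (χ-× (u Fin.<? v) ((u ∈? S) ×-dec (v ∈? S)))
                                  (cong (χ (u Fin.<? v) *_) (χ-× (u ∈? S) (v ∈? S)))))
      (ring (χ (u Fin.<? v)) (χ (u ∈? S)) (χ (v ∈? S)) (has a u v))

  edgesOfColour-∑ : ∀ {k} a (F : Factor k n) →
    edgesOfColour c a F ≡ ∑ (edgeCount a) (map elements (cliques F))
  edgesOfColour-∑ a F = begin
    length (filter Q? (edges F))                ≡⟨ length-filter Q? (edges F) ⟩
    ∑ f (concat (map cliqueEdges Ss))           ≡⟨ ∑-concat f (map cliqueEdges Ss) ⟩
    ∑ (∑ f) (map cliqueEdges Ss)                ≡⟨ ∑-map (∑ f) cliqueEdges Ss ⟩
    ∑ (λ S → ∑ f (cliqueEdges S)) Ss            ≡⟨ ∑-cong Ss (λ S _ → cliqueEdges-count a S) ⟩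
    ∑ (λ S → edgeCount a (elements S)) Ss       ≡⟨ sym (∑-map (edgeCount a) elements Ss) ⟩
    ∑ (edgeCount a) (map elements Ss)           ∎
    where
    open ≡-Reasoning
    Ss = cliques F
    Q? : ∀ p → Dec _
    Q? = λ (u , v) → colour c u v ≟ᶜ a
    f : Fin n × Fin n → ℕ
    f (u , v) = has a u v

-- Factors as partitions of the vertex list

elements-partition : ∀ {k n} (F : Factor k n) → concat (map elements (cliques F)) ↭ allFin n
elements-partition {k} {n} F = unique-sets-↭
  (Unique.concat⁺
    (All.map⁺ (All.tabulate λ {S} _ → elements-unique S))
    (AllPairs.map⁺ (AllPairs.map
      (λ emp {_} (v∈S , v∈T) → emp (_ , x∈p∩q⁺ (∈-elements⁻ v∈S , ∈-elements⁻ v∈T))) (disjoint F))))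
  (Unique.allFin⁺ n)
  (λ _ → ∈-allFin _)
  λ {v} _ → let S , S∈ , v∈S = find (covering F v)
            in ∈-concat⁺′ (∈-elements⁺ v∈S) (∈-map⁺ elements S∈)

-- The one permutation `covers` stands for both disjointness and covering, and it can be assembled
-- from permutations of parts of the vertex list.
record Partition (n k : ℕ) : Set where
  field
    blocks : List (List (Fin n))
    sizes  : All (λ xs → length xs ≡ k) blocks
    covers : concat blocks ↭ allFin n

AllPairs-resp-↭ : ∀ {A : Set} {R : A → A → Set} → (∀ {x y} → R x y → R y x) →
  ∀ {xs ys} → xs ↭ ys → AllPairs R xs → AllPairs R ys
AllPairs-resp-↭ s _↭_.refl ps = ps
AllPairs-resp-↭ s (_↭_.prep x p) (q ∷ ps) = All-resp-↭ p q ∷ AllPairs-resp-↭ s p ps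
AllPairs-resp-↭ s (_↭_.swap x y p) ((xy ∷ q) ∷ q′ ∷ ps) =
  (s xy ∷ All-resp-↭ p q′) ∷ All-resp-↭ p q ∷ AllPairs-resp-↭ s p ps
AllPairs-resp-↭ s (_↭_.trans p p′) ps = AllPairs-resp-↭ s p′ (AllPairs-resp-↭ s p ps)

AllPairs-++⁻ : ∀ {A : Set} {R : A → A → Set} xs {ys} → AllPairs R (xs ++ ys) →
  AllPairs R xs × AllPairs R ys × All (λ x → All (R x) ys) xs
AllPairs-++⁻ []       ps       = [] , ps , []
AllPairs-++⁻ (x ∷ xs) (p ∷ ps) =
  let q , r , s = AllPairs-++⁻ xs ps
  in All.++⁻ˡ xs p ∷ q , r , All.++⁻ʳ xs p ∷ s

AllPairs-concat⁻ : ∀ {A : Set} {R : A → A → Set} xss → AllPairs R (concat xss) →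
  All (AllPairs R) xss × AllPairs (λ xs ys → All (λ x → All (R x) ys) xs) xss
AllPairs-concat⁻ []         ps = [] , []
AllPairs-concat⁻ (xs ∷ xss) ps =
  let q , r , s = AllPairs-++⁻ xs ps
      t , u = AllPairs-concat⁻ xss r
  in q ∷ t , All.All-swap (All.map All.concat⁻ s) ∷ u

module _ {n k : ℕ} (P : Partition n k) where
  open Partition P

  private
    unique : All Unique blocks × AllPairs (λ xs ys → All (λ x → All (x ≢_) ys) xs) blocks
    unique = AllPairs-concat⁻ blocks
      (AllPairs-resp-↭ (λ x≢y y≡x → x≢y (sym y≡x)) (↭-sym covers) (Unique.allFin⁺ n))

    length-blocks : ∀ {xss : List (List (Fin n))} → All (λ xs → length xs ≡ k) xss →
                    length xss * k ≡ length (concat xss)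
    length-blocks []               = refl
    length-blocks {xs ∷ xss} (p ∷ ps) =
      trans (cong₂ _+_ (sym p) (length-blocks ps)) (sym (length-++ xs))

    length-allFin : ∀ n → length (allFin n) ≡ n
    length-allFin n = length-tabulate id

    in-block : ∀ {v : Fin n} {xss} → v ∈ concat xss → Any (λ S → v ∈ˢ S) (map fromList xss)
    in-block {xss = xs ∷ xss} v∈ with ∈-++⁻ xs v∈
    ... | inj₁ v∈xs  = here (∈-fromList⁺ v∈xs)
    ... | inj₂ v∈xss = there (in-block v∈xss)

    sizes⁺ : ∀ {xss : List (List (Fin n))} → All Unique xss → All (λ xs → length xs ≡ k) xss →
             All (λ S → card S ≡ k) (map fromList xss)
    sizes⁺ []         []       = []
    sizes⁺ {xs ∷ _} (xs! ∷ us) (p ∷ ps) =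
      trans (card-elements (fromList xs)) (trans (↭-length (elements-fromList xs!)) p) ∷ sizes⁺ us ps

  toFactor : Factor k n
  toFactor = record
    { cliques  = map fromList blocks
    ; number   = trans (cong (_* k) (length-map fromList blocks))
                   (trans (length-blocks sizes) (trans (↭-length covers) (length-allFin n)))
    ; size     = sizes⁺ (proj₁ unique) sizes
    ; disjoint = AllPairs.map⁺ (AllPairs.map
        (λ {xs} {ys} ≢s (v , v∈) →
          let v∈xs , v∈ys = x∈p∩q⁻ _ _ v∈
          in All.lookup (All.lookup ≢s (∈-fromList⁻ xs v∈xs)) (∈-fromList⁻ ys v∈ys) refl)
        (proj₂ unique))
    ; covering = λ v → in-block (∈-resp-↭ (↭-sym covers) (∈-allFin v))
    }

  edgesOfColour-toFactor : ∀ (c : Colouring n) a →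
    edgesOfColour c a toFactor ≡ ∑ (Counting.edgeCount c a) blocks
  edgesOfColour-toFactor c a = trans (edgesOfColour-∑ a toFactor) (go (proj₁ unique))
    where
    open Counting c
    go : ∀ {xss} → All Unique xss →
         ∑ (edgeCount a) (map elements (map fromList xss)) ≡ ∑ (edgeCount a) xss
    go []                       = refl
    go {xs ∷ xss} (xs! ∷ us) = cong₂ _+_
      (edgeCount-↭ a (elements-unique (fromList xs)) xs! (elements-fromList xs!)) (go us)

-- Edge counts of two joined cliques

opposite-≢ : ∀ a → opposite a ≢ a
opposite-≢ red  ()
opposite-≢ blue ()

≢-opposite : ∀ {a b} → b ≢ a → b ≡ opposite a
≢-opposite {red}  {red}  b≢a = ⊥-elim (b≢a refl)
≢-opposite {red}  {blue} b≢a = refl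
≢-opposite {blue} {red}  b≢a = refl
≢-opposite {blue} {blue} b≢a = ⊥-elim (b≢a refl)

opposite-involutive : ∀ a → opposite (opposite a) ≡ a
opposite-involutive red  = refl
opposite-involutive blue = refl

module CliqueCounting {n : ℕ} (c : Colouring n) where

  open Counting c public

  Mono : Colour → List (Fin n) → Set
  Mono a = AllPairs (λ u v → colour c u v ≡ a)

  Joined : Colour → List (Fin n) → List (Fin n) → Set
  Joined a A B = All (λ u → All (λ v → colour c u v ≡ a) B) A

  degree-all : ∀ {a x ys} → All (λ y → colour c x y ≡ a) ys → degree a x ys ≡ length ys
  degree-all []                   = refl
  degree-all {a} {x} {y ∷ ys} (p ∷ ps) = cong₂ _+_ (χ-yes (colour c x y ≟ᶜ a) p) (degree-all ps)

  degree-none : ∀ {a b x ys} → b ≢ a → All (λ y → colour c x y ≡ b) ys → degree a x ys ≡ 0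
  degree-none b≢a [] = refl
  degree-none {a} {b} {x} {y ∷ ys} b≢a (p ∷ ps) =
    cong₂ _+_ (χ-no (colour c x y ≟ᶜ a) (λ q → b≢a (trans (sym p) q))) (degree-none b≢a ps)

  edgeCount-++ : ∀ a A B → edgeCount a (A ++ B) ≡ edgeCount a A + edgeCount a B + ∑ (λ x → degree a x B) A
  edgeCount-++ a []      B = sym (+-identityʳ _)
  edgeCount-++ a (x ∷ A) B = trans (cong₂ _+_ (∑-++ (has a x) A B) (edgeCount-++ a A B))
    (ring (degree a x A) (degree a x B) (edgeCount a A) (edgeCount a B) (∑ (λ x → degree a x B) A))
    where
    ring : ∀ p q r s t → p + q + (r + s + t) ≡ p + r + s + (q + t)
    ring = solve-∀

  edgeCount-mono : ∀ {a A} → Mono a A → 2 * edgeCount a A + length A ≡ length A * length A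
  edgeCount-mono []                      = refl
  edgeCount-mono {a} {x ∷ A} (p ∷ ps) =
    trans (cong (λ d → 2 * (d + edgeCount a A) + suc l) (degree-all p))
    (trans (ring₁ l (edgeCount a A)) (trans (cong (_+ (1 + 2 * l)) (edgeCount-mono ps)) (ring₂ l)))
    where
    l = length A
    ring₁ : ∀ l e → 2 * (l + e) + suc l ≡ 2 * e + l + (1 + 2 * l)
    ring₁ = solve-∀
    ring₂ : ∀ l → l * l + (1 + 2 * l) ≡ suc l * suc l
    ring₂ = solve-∀

  edgeCount-other : ∀ {a b A} → b ≢ a → Mono b A → edgeCount a A ≡ 0
  edgeCount-other b≢a []       = refl
  edgeCount-other b≢a (p ∷ ps) = cong₂ _+_ (degree-none b≢a p) (edgeCount-other b≢a ps)

  degrees-joined : ∀ {a A B} → Joined a A B → ∑ (λ x → degree a x B) A ≡ length A * length B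
  degrees-joined []       = refl
  degrees-joined (p ∷ ps) = cong₂ _+_ (degree-all p) (degrees-joined ps)

  degrees-unjoined : ∀ {a b A B} → b ≢ a → Joined b A B → ∑ (λ x → degree a x B) A ≡ 0
  degrees-unjoined b≢a []       = refl
  degrees-unjoined b≢a (p ∷ ps) = cong₂ _+_ (degree-none b≢a p) (degrees-unjoined b≢a ps)

  module _ {a A B} (A-mono : Mono a A) (B-mono : Mono (opposite a) B) (joined : Joined a A B) where

    edgeCount-join : 2 * edgeCount a (A ++ B) + length A ≡ length A * length A + 2 * (length A * length B)
    edgeCount-join = trans (cong (λ e → 2 * e + length A) eq)
      (trans (ring (edgeCount a A) (length A) (length A * length B)) (cong (_+ 2 * (length A * length B)) (edgeCount-mono A-mono)))
      where
      eq : edgeCount a (A ++ B) ≡ edgeCount a A + 0 + length A * length B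
      eq = trans (edgeCount-++ a A B) (cong₂ (λ s t → edgeCount a A + s + t)
             (edgeCount-other (opposite-≢ a) B-mono) (degrees-joined joined))
      ring : ∀ e l p → 2 * (e + 0 + p) + l ≡ 2 * e + l + 2 * p
      ring = solve-∀

    edgeCount-join-opposite : 2 * edgeCount (opposite a) (A ++ B) + length B ≡ length B * length B
    edgeCount-join-opposite = trans (cong (λ e → 2 * e + length B) eq) (edgeCount-mono B-mono)
      where
      a≢ : a ≢ opposite a
      a≢ p = opposite-≢ a (sym p)
      eq : edgeCount (opposite a) (A ++ B) ≡ edgeCount (opposite a) B
      eq = trans (edgeCount-++ (opposite a) A B) (trans (cong₂ (λ s t → s + edgeCount (opposite a) B + t)
             (edgeCount-other a≢ A-mono) (degrees-unjoined a≢ joined)) (+-identityʳ _))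

filter-∁-↭ : ∀ {A : Set} {P : A → Set} (P? : Decidable P) xs → xs ↭ filter P? xs ++ filter (¬? ∘ P?) xs
filter-∁-↭ P? []       = ↭-refl
filter-∁-↭ P? (x ∷ xs) with P? x
... | yes _ = ↭-prep x (filter-∁-↭ P? xs)
... | no  _ = ↭-trans (↭-prep x (filter-∁-↭ P? xs)) (↭-sym (↭.shift x (filter P? xs) (filter (¬? ∘ P?) xs)))

AllPairs-universal : ∀ {A : Set} {P : A → Set} {R : A → A → Set} → (∀ {x y} → P x → P y → R x y) →
  ∀ {xs} → All P xs → AllPairs R xs
AllPairs-universal r []       = []
AllPairs-universal r (p ∷ ps) = All.map (r p) ps ∷ AllPairs-universal r ps

-- Upper bounds for factors of the bipartite construction

module Bipartite {n : ℕ} (X : Subset n) (a : Colour) where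

  open CliqueCounting (bipartite X a)

  colour-X : ∀ {u v} → u ∈ˢ X → colour (bipartite X a) u v ≡ a
  colour-X u∈X rewrite []=⇒lookup u∈X = refl

  colour-Y : ∀ {u v} → ¬ u ∈ˢ X → ¬ v ∈ˢ X → colour (bipartite X a) u v ≡ opposite a
  colour-Y {u} {v} u∉X v∉X with lookup X u in equ | lookup X v in eqv
  ... | true  | _     = ⊥-elim (u∉X (lookup⇒[]= u X equ))
  ... | false | true  = ⊥-elim (v∉X (lookup⇒[]= v X eqv))
  ... | false | false = refl

  inX : List (Fin n) → ℕ
  inX xs = ∑ (λ v → χ (v ∈? X)) xs

  edgeCounts : ∀ {xs} → Unique xs → ∃[ m ] (inX xs + m ≡ length xs
    × 2 * edgeCount a xs + inX xs ≡ inX xs * inX xs + 2 * (inX xs * m)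
    × 2 * edgeCount (opposite a) xs + m ≡ m * m)
  edgeCounts {xs} xs! = length B
    , trans (cong (_+ length B) inX≡) (trans (sym (length-++ A)) (sym (↭-length split)))
    , subst₂ (λ e l → 2 * e + l ≡ l * l + 2 * (l * length B)) (sym (same a)) (sym inX≡) (edgeCount-join A-mono B-mono joined)
    , subst (λ e → 2 * e + length B ≡ length B * length B) (sym (same (opposite a))) (edgeCount-join-opposite A-mono B-mono joined)
    where
    A B : List (Fin n)
    A = filter (_∈? X) xs
    B = filter (¬? ∘ (_∈? X)) xs
    split : xs ↭ A ++ B
    split = filter-∁-↭ (_∈? X) xs
    inX≡ : inX xs ≡ length A
    inX≡ = sym (length-filter (_∈? X) xs)
    A⊆X : All (_∈ˢ X) A
    A⊆X = All.all-filter (_∈? X) xs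
    A-mono : Mono a A
    A-mono = AllPairs-universal (λ u∈X _ → colour-X u∈X) A⊆X
    B-mono : Mono (opposite a) B
    B-mono = AllPairs-universal colour-Y (All.all-filter (¬? ∘ (_∈? X)) xs)
    joined : Joined a A B
    joined = All.map (λ u∈X → All.tabulate λ _ → colour-X u∈X) A⊆X
    same : ∀ b → edgeCount b xs ≡ edgeCount b (A ++ B)
    same b = edgeCount-↭ b xs! (AllPairs-resp-↭ (λ x≢y y≡x → x≢y (sym y≡x)) split xs!) split

  -- The count is concave in j = inX xs and lies below a tangent at i, because
  -- (i - j)(i - j + 1) ≥ 0 for integers.
  edgeCount-tangent : ∀ i {k xs} → Unique xs → length xs ≡ k →
    2 * edgeCount a xs + 2 * (suc i) * inX xs ≤ i * suc i + 2 * k * inX xs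
  edgeCount-tangent i {k} {xs} xs! refl with edgeCounts xs!
  ... | m , len , ea , _ rewrite sym len =
    linear (consecutive i (inX xs))
      (trans (ring₁ (edgeCount a xs) i (inX xs))
        (trans (cong (_+ (i * suc i + 2 * i * inX xs + inX xs + inX xs * inX xs)) ea)
               (ring₂ i (inX xs) m)))
    where
    consecutive : ∀ i j → j + 2 * i * j ≤ i * suc i + j * j
    consecutive zero    zero    = z≤n
    consecutive zero    (suc j) = s≤s (+-monoʳ-≤ j z≤n)
    consecutive (suc i) zero    = subst (_≤ suc i * suc (suc i) + 0) (sym (*-zeroʳ (2 * suc i))) z≤n
    -- The difference of the two sides depends only on i - j, so both arguments drop by one
    -- together.
    consecutive (suc i) (suc j) = linear (consecutive i j) (ring i j)
      where
      ring : ∀ i j → suc j + 2 * suc i * suc j + (i * suc i + j * j) ≡ suc i * suc (suc i) + suc j * suc j + (j + 2 * i * j)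
      ring = solve-∀
    ring₁ : ∀ e i j → 2 * e + 2 * suc i * j + (i * suc i + j * j) ≡ 2 * e + j + (i * suc i + 2 * i * j + j + j * j)
    ring₁ = solve-∀
    ring₂ : ∀ i j m → j * j + 2 * (j * m) + (i * suc i + 2 * i * j + j + j * j) ≡ i * suc i + 2 * (j + m) * j + (j + 2 * i * j)
    ring₂ = solve-∀

  -- With m = k - j vertices outside `X`, the convex count m(m - 1) lies below its chord (k - 1)m.
  -- The slack is jm, so pure cliques are exactly the case of equality.
  edgeCount-outside : ∀ {k xs} → Unique xs → length xs ≡ k →
    2 * edgeCount (opposite a) xs + k + k * inX xs ≤ k * k + inX xs
  edgeCount-outside {k} {xs} xs! refl with edgeCounts xs!
  ... | m , len , _ , eb rewrite sym len =
    linear (z≤n {inX xs * m}) (trans (ring₁ (edgeCount (opposite a) xs) (inX xs) m)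
      (trans (cong (_+ (inX xs + (inX xs + m) * inX xs + inX xs * m)) eb) (ring₂ (inX xs) m)))
    where
    ring₁ : ∀ e j m → 2 * e + (j + m) + (j + m) * j + j * m ≡ 2 * e + m + (j + (j + m) * j + j * m)
    ring₁ = solve-∀
    ring₂ : ∀ j m → m * m + (j + (j + m) * j + j * m) ≡ (j + m) * (j + m) + j + 0
    ring₂ = solve-∀

  module _ {k : ℕ} (F : Factor k n) where

    private
      blocks : List (List (Fin n))
      blocks = map elements (cliques F)

      w : ℕ
      w = length (cliques F)

      ∑-inX : ∑ inX blocks ≡ card X
      ∑-inX = trans (sym (∑-concat _ blocks)) (trans (∑-↭ _ (elements-partition F)) (sym (card-∑ X)))

      ∑-blocks-const : ∀ t → ∑ (λ (_ : List (Fin n)) → t) blocks ≡ w * t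
      ∑-blocks-const t = trans (∑-const t blocks) (cong (_* t) (length-map elements (cliques F)))

      blocks-sized : ∀ {xs} → xs ∈ blocks → Unique xs × length xs ≡ k
      blocks-sized xs∈ with ∈-map⁻ elements xs∈
      ... | S , S∈ , refl = elements-unique S , trans (sym (card-elements S)) (All.lookup (size F) S∈)

    -- The bound on a block is linear in `inX`, so its sum over the factor involves only `card X`,
    -- however the cliques share `X` among them.
    edgesOfColour-tangent : ∀ i →
      2 * edgesOfColour (bipartite X a) a F + 2 * (suc i) * card X ≤ w * (i * suc i) + 2 * k * card X
    edgesOfColour-tangent i = subst₂ _≤_ lhs rhs
      (∑-mono {f = λ xs → 2 * edgeCount a xs + 2 * (suc i) * inX xs}
        {g = λ xs → i * suc i + 2 * k * inX xs} blocks
        λ xs xs∈ → let xs! , len = blocks-sized xs∈ in edgeCount-tangent i xs! len)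
      where
      lhs = trans (∑-+ _ _ blocks) (cong₂ _+_
        (trans (∑-*ˡ 2 _ blocks) (cong (2 *_) (sym (edgesOfColour-∑ a F))))
        (trans (∑-*ˡ (2 * suc i) _ blocks) (cong (2 * suc i *_) ∑-inX)))
      rhs = trans (∑-+ _ _ blocks) (cong₂ _+_ (∑-blocks-const (i * suc i))
        (trans (∑-*ˡ (2 * k) _ blocks) (cong (2 * k *_) ∑-inX)))

    edgesOfColour-outside :
      2 * edgesOfColour (bipartite X a) (opposite a) F + w * k + k * card X ≤ w * (k * k) + card X
    edgesOfColour-outside = subst₂ _≤_ lhs rhs
      (∑-mono {f = λ xs → 2 * edgeCount (opposite a) xs + k + k * inX xs}
        {g = λ xs → k * k + inX xs} blocks
        λ xs xs∈ → let xs! , len = blocks-sized xs∈ in edgeCount-outside xs! len)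
      where
      lhs = trans (∑-+ _ _ blocks) (cong₂ _+_
        (trans (∑-+ _ _ blocks) (cong₂ _+_
          (trans (∑-*ˡ 2 _ blocks) (cong (2 *_) (sym (edgesOfColour-∑ (opposite a) F)))) (∑-blocks-const k)))
        (trans (∑-*ˡ k _ blocks) (cong (k *_) ∑-inX)))
      rhs = trans (∑-+ _ _ blocks) (cong₂ _+_ (∑-blocks-const (k * k)) ∑-inX)

-- Ramsey's theorem and its bipartite version

split-at : ∀ {A : Set} m {m′} (xs : List A) → length xs ≡ m + m′ →
  ∃[ ys ] ∃[ zs ] (xs ≡ ys ++ zs × length ys ≡ m × length zs ≡ m′)
split-at zero    xs       eq = [] , xs , refl , refl , eq
split-at (suc m) (x ∷ xs) eq with split-at m xs (suc-injective eq)
... | ys , zs , refl , len , len′ = x ∷ ys , zs , refl , cong suc len , len′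

split-≤ : ∀ {A : Set} m (xs : List A) → m ≤ length xs →
  ∃[ ys ] ∃[ zs ] (xs ≡ ys ++ zs × length ys ≡ m)
split-≤ m xs m≤ =
  let ys , zs , eq , len , _ = split-at m xs (sym (m+[n∸m]≡n m≤)) in ys , zs , eq , len

-- The one unit of slack pays for the vertex that is removed before the others are split by colour.
larger-half : ∀ M {f g} → M + M ≤ suc (f + g) → M ≤ f ⊎ M ≤ g
larger-half M {f} {g} le with M ≤? f | M ≤? g
... | yes p | _     = inj₁ p
... | no _  | yes q = inj₂ q
... | no ¬p | no ¬q = ⊥-elim (<⇒≱ (subst (_≤ M + M) (cong suc (+-suc f g)) (+-mono-≤ (≰⇒> ¬p) (≰⇒> ¬q))) le)

++-interchange-↭ : ∀ {A : Set} (xs ys zs ts : List A) → (xs ++ ys) ++ (zs ++ ts) ↭ (xs ++ zs) ++ (ys ++ ts)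
++-interchange-↭ xs ys zs ts = ↭-trans (↭.++-assoc xs ys (zs ++ ts))
  (↭-trans (↭.++⁺ˡ xs (↭.shifts ys zs)) (↭-sym (↭.++-assoc xs zs (ys ++ ts))))

module Ramsey {n : ℕ} (c : Colouring n) where

  open CliqueCounting c public

  V : Set
  V = Fin n

  -- The unchosen vertices are kept in `splits`, so that cliques can be cut out of a vertex list one
  -- after another.
  record HasClique (a : Colour) (U : List V) (p : ℕ) : Set where
    constructor clique
    field
      {chosen others} : List V
      splits     : U ↭ chosen ++ others
      size       : length chosen ≡ p
      mono       : Mono a chosen

  record HasBiclique (a : Colour) (A B : List V) (p q : ℕ) : Set where
    constructor biclique
    field
      {A₁ A₂ B₁ B₂} : List V
      splitsA : A ↭ A₁ ++ A₂
      splitsB : B ↭ B₁ ++ B₂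
      sizeA   : length A₁ ≡ p
      sizeB   : length B₁ ≡ q
      joined  : Joined a A₁ B₁

  module _ (a : Colour) (x : V) where

    nbrs non-nbrs : List V → List V
    nbrs     = filter (λ y → colour c x y ≟ᶜ a)
    non-nbrs = filter (¬? ∘ λ y → colour c x y ≟ᶜ a)

    split-nbrs : ∀ ys → ys ↭ nbrs ys ++ non-nbrs ys
    split-nbrs = filter-∁-↭ _

    split-non-nbrs : ∀ ys → ys ↭ non-nbrs ys ++ nbrs ys
    split-non-nbrs ys = ↭-trans (split-nbrs ys) (↭.++-comm (nbrs ys) (non-nbrs ys))

    nbrs-colour : ∀ ys → All (λ y → colour c x y ≡ a) (nbrs ys)
    nbrs-colour = All.all-filter _

    non-nbrs-colour : ∀ ys → All (λ y → colour c x y ≡ opposite a) (non-nbrs ys)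
    non-nbrs-colour ys = All.map ≢-opposite (All.all-filter _ ys)

    length-nbrs : ∀ ys → length ys ≡ length (nbrs ys) + length (non-nbrs ys)
    length-nbrs ys = trans (↭-length (split-nbrs ys)) (length-++ (nbrs ys))

  clique-∷ : ∀ {b x xs S T p} → xs ↭ S ++ T → All (λ y → colour c x y ≡ b) S →
             HasClique b S p → HasClique b (x ∷ xs) (suc p)
  clique-∷ {T = T} sp S-col (clique {C} {D} e s m) = clique {others = D ++ T}
    (↭-prep _ (↭-trans sp (↭-trans (↭.++⁺ʳ T e) (↭.++-assoc C D T))))
    (cong suc s) (All.++⁻ˡ C (All-resp-↭ e S-col) ∷ m)

  clique-⊇ : ∀ {b x xs S T p} → xs ↭ S ++ T → HasClique b S p → HasClique b (x ∷ xs) p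
  clique-⊇ {x = x} {T = T} sp (clique {C} {D} e s m) = clique {others = x ∷ (D ++ T)}
    (↭-trans (↭-prep x (↭-trans sp (↭-trans (↭.++⁺ʳ T e) (↭.++-assoc C D T)))) (↭-sym (↭.shift x C (D ++ T))))
    s m

  biclique-∷ : ∀ {b x A B S T p q} → B ↭ S ++ T → All (λ y → colour c x y ≡ b) S →
               HasBiclique b A S p q → HasBiclique b (x ∷ A) B (suc p) q
  biclique-∷ {x = x} {T = T} sp S-col (biclique {A₁} {A₂} {B₁} {B₂} eA eB sA sB j) =
    biclique {A₂ = A₂} {B₂ = B₂ ++ T} (↭-prep x eA) (↭-trans sp (↭-trans (↭.++⁺ʳ T eB) (↭.++-assoc B₁ B₂ T)))
      (cong suc sA) sB (All.++⁻ˡ B₁ (All-resp-↭ eB S-col) ∷ j)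

  biclique-⊇ : ∀ {b x A B S T p q} → B ↭ S ++ T → HasBiclique b A S p q → HasBiclique b (x ∷ A) B p q
  biclique-⊇ {x = x} {T = T} sp (biclique {A₁} {A₂} {B₁} {B₂} eA eB sA sB j) =
    biclique {A₂ = x ∷ A₂} {B₂ = B₂ ++ T} (↭-trans (↭-prep x eA) (↭-sym (↭.shift x A₁ A₂)))
      (↭-trans sp (↭-trans (↭.++⁺ʳ T eB) (↭.++-assoc B₁ B₂ T))) sA sB j

  module _ {a : Colour} where

    -- The first vertex passes to a colour class that is still large enough. A clique of that colour
    -- found there extends by the vertex, one of the other colour is used as it is.
    ramsey : ∀ p q xs → 2 ^ (p + q) ≤ length xs → HasClique a xs p ⊎ HasClique (opposite a) xs q
    ramsey zero    q       xs big = inj₁ (clique ↭-refl refl [])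
    ramsey (suc p) zero    xs big = inj₂ (clique ↭-refl refl [])
    ramsey (suc p) (suc q) [] big = ⊥-elim (<⇒≱ (m^n>0 2 (suc p + suc q)) big)
    ramsey (suc p) (suc q) (x ∷ xs) big
      with larger-half (2 ^ (p + suc q)) {length (nbrs a x xs)} {length (non-nbrs a x xs)}
             (subst₂ _≤_ (cong (2 ^ (p + suc q) +_) (+-identityʳ _)) (cong suc (length-nbrs a x xs)) big)
    ... | inj₁ big′ with ramsey p (suc q) (nbrs a x xs) big′
    ...   | inj₁ C = inj₁ (clique-∷ (split-nbrs a x xs) (nbrs-colour a x xs) C)
    ...   | inj₂ C = inj₂ (clique-⊇ (split-nbrs a x xs) C)
    ramsey (suc p) (suc q) (x ∷ xs) big | inj₂ big′
      with ramsey (suc p) q (non-nbrs a x xs) (subst (λ t → 2 ^ t ≤ length (non-nbrs a x xs)) (+-suc p q) big′)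
    ... | inj₁ C = inj₁ (clique-⊇ (split-non-nbrs a x xs) C)
    ... | inj₂ C = inj₂ (clique-∷ (split-non-nbrs a x xs) (non-nbrs-colour a x xs) C)

    -- Vertices of `A` are read one by one, each keeping a colour class with at least half of what
    -- remains of `B`. After at most `p + p′` halvings one colour has been kept often enough, and
    -- the vertices that kept the other colour join the leftover. Only `B` has to be exponentially
    -- large.
    bipartite-ramsey : ∀ p p′ q A B → p + p′ ≤ length A → 2 ^ (p + p′) * q ≤ length B →
      HasBiclique a A B p q ⊎ HasBiclique (opposite a) A B p′ q
    bipartite-ramsey zero p′ q A B _ big =
      let B₁ , B₂ , eq , len = split-≤ q B (≤-trans (m≤n*m q (2 ^ p′) ⦃ m^n≢0 2 p′ ⦄) big)
      in inj₁ (biclique {A₁ = []} {A} {B₁} {B₂} ↭-refl (↭-reflexive eq) refl len [])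
    bipartite-ramsey (suc p) zero q (x ∷ A) B _ big =
      let B₁ , B₂ , eq , len = split-≤ q B (≤-trans (m≤n*m q (2 ^ (suc p + 0)) ⦃ m^n≢0 2 (suc p + 0) ⦄) big)
      in inj₂ (biclique {A₁ = []} {A₂ = x ∷ A} {B₁} {B₂} ↭-refl (↭-reflexive eq) refl len [])
    bipartite-ramsey (suc p) (suc p′) q (x ∷ A) B (s≤s bigA) bigB
      with larger-half (2 ^ (p + suc p′) * q) {length (nbrs a x B)} {length (non-nbrs a x B)}
             (m≤n⇒m≤1+n (subst₂ _≤_ (ring (2 ^ (p + suc p′)) q) (length-nbrs a x B) bigB))
      where
      ring : ∀ M q → 2 * M * q ≡ M * q + M * q
      ring = solve-∀
    ... | inj₁ big′ with bipartite-ramsey p (suc p′) q A (nbrs a x B) bigA big′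
    ...   | inj₁ C = inj₁ (biclique-∷ (split-nbrs a x B) (nbrs-colour a x B) C)
    ...   | inj₂ C = inj₂ (biclique-⊇ (split-nbrs a x B) C)
    bipartite-ramsey (suc p) (suc p′) q (x ∷ A) B (s≤s bigA) bigB | inj₂ big′
      with bipartite-ramsey (suc p) p′ q A (non-nbrs a x B) (subst (_≤ length A) (+-suc p p′) bigA)
             (subst (λ t → 2 ^ t * q ≤ length (non-nbrs a x B)) (+-suc p p′) big′)
    ... | inj₁ C = inj₁ (biclique-⊇ (split-non-nbrs a x B) C)
    ... | inj₂ C = inj₂ (biclique-∷ (split-non-nbrs a x B) (non-nbrs-colour a x B) C)

-- Packings with copies of K_k

module Packings {n : ℕ} (c : Colouring n) (k : ℕ) where

  open Ramsey c public

  -- Edges are counted twice throughout, so that k(k-1)/2 needs no division.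
  record Packing (a : Colour) (U : List V) (t : ℕ) : Set where
    constructor packing
    field
      blocks : List (List V)
      rest   : List V
      sizes  : All (λ xs → length xs ≡ k) blocks
      covers : concat blocks ++ rest ↭ U
      count  : t ≤ 2 * ∑ (edgeCount a) blocks

  packing-[] : ∀ {a} U → Packing a U 0
  packing-[] U = packing [] U [] ↭-refl z≤n

  packing-≤ : ∀ {a U s t} → s ≤ t → Packing a U t → Packing a U s
  packing-≤ s≤t (packing bs rs si co ct) = packing bs rs si co (≤-trans s≤t ct)

  packing-↭ : ∀ {a U W t} → U ↭ W → Packing a U t → Packing a W t
  packing-↭ p (packing bs rs si co ct) = packing bs rs si (↭-trans co p) ct

  packing-++ : ∀ {a U W s t} → Packing a U s → Packing a W t → Packing a (U ++ W) (s + t)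
  packing-++ {a} (packing bs rs si co ct) (packing bs′ rs′ si′ co′ ct′) =
    packing (bs ++ bs′) (rs ++ rs′) (All.++⁺ si si′)
      (↭-trans (↭-reflexive (cong (_++ (rs ++ rs′)) (sym (concat-++ bs bs′))))
        (↭-trans (++-interchange-↭ (concat bs) (concat bs′) rs rs′) (↭.++⁺ co co′)))
      (≤-trans (+-mono-≤ ct ct′) (≤-reflexive
        (trans (sym (*-distribˡ-+ 2 (∑ (edgeCount a) bs) (∑ (edgeCount a) bs′)))
               (cong (2 *_) (sym (∑-++ (edgeCount a) bs bs′))))))

  packing-block : ∀ {a} xs → length xs ≡ k → Packing a xs (2 * edgeCount a xs)
  packing-block {a} xs len = packing (xs ∷ []) [] (len ∷ [])
    (↭-reflexive (trans (++-identityʳ _) (++-identityʳ xs)))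
    (≤-reflexive (cong (2 *_) (sym (+-identityʳ (edgeCount a xs)))))

  joined-sym : ∀ {a A B} → Joined a A B → Joined a B A
  joined-sym j = All.map (All.map (λ {u} p → trans (symmetric c _ u) p)) (All.All-swap j)

  joined-++⁻ : ∀ {a} A₁ {A₂} B₁ {B₂} → Joined a (A₁ ++ A₂) (B₁ ++ B₂) →
    Joined a A₁ B₁ × Joined a A₂ B₂
  joined-++⁻ A₁ B₁ j = All.map (All.++⁻ˡ B₁) (All.++⁻ˡ A₁ j) , All.map (All.++⁻ʳ B₁) (All.++⁻ʳ A₁ j)

  mono-++⁻ : ∀ {a} A₁ {A₂} → Mono a (A₁ ++ A₂) → Mono a A₁ × Mono a A₂
  mono-++⁻ A₁ m = let m₁ , m₂ , _ = AllPairs-++⁻ A₁ m in m₁ , m₂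

  -- Here `t` is p(p - 1) + 2pq, twice the number of `a`-edges in a block with `p` vertices in `A`
  -- and `q` in `B`.
  uniform-packing : ∀ {a p q t} → p + q ≡ k → t + p ≡ p * p + 2 * (p * q) →
    ∀ m {A B} → length A ≡ m * p → length B ≡ m * q →
    Mono a A → Mono (opposite a) B → Joined a A B → Packing a (A ++ B) (m * t)
  uniform-packing pq tq zero lA lB mA mB j = packing-[] _
  uniform-packing {a} {p} {q} {t} pq tq (suc m) {A} {B} lA lB mA mB j
    with split-at p A lA | split-at q B lB
  ... | A₁ , A₂ , refl , lA₁ , lA₂ | B₁ , B₂ , refl , lB₁ , lB₂ =
    let mA₁ , mA₂ = mono-++⁻ A₁ mA
        mB₁ , mB₂ = mono-++⁻ B₁ mB
        j₁  , j₂  = joined-++⁻ A₁ B₁ j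
    in packing-↭ (++-interchange-↭ A₁ B₁ A₂ B₂)
         (packing-++
           (packing-≤ (t≤ lA₁ lB₁ mA₁ mB₁ j₁)
             (packing-block (A₁ ++ B₁) (trans (length-++ A₁) (trans (cong₂ _+_ lA₁ lB₁) pq))))
           (uniform-packing pq tq m lA₂ lB₂ mA₂ mB₂ j₂))
    where
    t≤ : ∀ {A₁ B₁} → length A₁ ≡ p → length B₁ ≡ q →
         Mono a A₁ → Mono (opposite a) B₁ → Joined a A₁ B₁ →
         t ≤ 2 * edgeCount a (A₁ ++ B₁)
    t≤ refl refl mA₁ mB₁ j₁ = ≤-reflexive (+-cancelʳ-≡ p t _ (trans tq (sym (edgeCount-join mA₁ mB₁ j₁))))

  -- The two weights are p(p - 1) + 2p(k - p) for p = `i` and p = `suc i`, expanded without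
  -- subtraction.
  mixed-packing : ∀ {a i r} → suc (i + r) ≡ k → ∀ u v {A B} →
    length A ≡ u * i + v * suc i → length B ≡ u * suc r + v * r →
    Mono a A → Mono (opposite a) B → Joined a A B →
    Packing a (A ++ B) (u * (i * i + 2 * i * r + i) + v * (i * i + i + 2 * i * r + 2 * r))
  mixed-packing {a} {i} {r} ik u v {A} {B} lA lB mA mB j
    with split-at (u * i) A lA | split-at (u * suc r) B lB
  ... | A₁ , A₂ , refl , lA₁ , lA₂ | B₁ , B₂ , refl , lB₁ , lB₂ =
    let mA₁ , mA₂ = mono-++⁻ A₁ mA
        mB₁ , mB₂ = mono-++⁻ B₁ mB
        j₁  , j₂  = joined-++⁻ A₁ B₁ j
    in packing-↭ (++-interchange-↭ A₁ B₁ A₂ B₂)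
         (packing-++ (uniform-packing (trans (+-suc i r) ik) (ring₁ i r) u lA₁ lB₁ mA₁ mB₁ j₁)
                     (uniform-packing ik (ring₂ i r) v lA₂ lB₂ mA₂ mB₂ j₂))
    where
    ring₁ : ∀ i r → i * i + 2 * i * r + i + i ≡ i * i + 2 * (i * suc r)
    ring₁ = solve-∀
    ring₂ : ∀ i r → i * i + i + 2 * i * r + 2 * r + suc i ≡ suc i * suc i + 2 * (suc i * r)
    ring₂ = solve-∀

  pure-packing : ∀ {a A} m {r} → suc r ≡ k → length A ≡ m * k → Mono a A → Packing a A (m * (k * r))
  pure-packing {A = A} m {r} refl lA mA = packing-↭ (↭-reflexive (++-identityʳ A))
    (uniform-packing (+-identityʳ k) (ring r) m lA (sym (*-zeroʳ m)) mA [] (All.tabulate λ _ → []))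
    where
    ring : ∀ r → suc r * r + suc r ≡ suc r * suc r + 2 * (suc r * 0)
    ring = solve-∀

-- The critical tile

-- A tile consists of k s vertices of one clique and k l vertices of a clique of
-- the opposite colour; it splits into k u mixed copies of K_k with i vertices on
-- the small side and k v copies with i + 1. At the critical ratio s / (s + l)
-- these copies, if joined in the colour of the small side, have as many edges of
-- that colour as a factor of the large side has of its own (balance), and k E
-- is twice this number.
record Parameters (k : ℕ) : Set where
  field
    i r u v : ℕ
    k≡      : suc (i + r) ≡ k
    i+r>0   : 0 < i + r
    u-def   : u + r * r ≡ i * i + i + i * r + 2 * r
    v-def   : v + (i * i + i * r) ≡ r * r + r

  s l E : ℕ
  s = u * i + v * suc i
  l = u * suc r + v * r
  E = l * (i + r)

  -- Compared with the pure share of its large part, and counting edges twice, a copy of the first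
  -- kind falls short by `v` and a copy of the second kind is ahead by `u`. Hence `u` copies of the
  -- first and `v` of the second cancel, which is where `u-def` and `v-def` come from. Adding
  -- `u * v` to both sides avoids subtraction.
  balance : u * (i * i + 2 * i * r + i) + v * (i * i + i + 2 * i * r + 2 * r) ≡ E
  balance = +-cancelʳ-≡ (u * v) _ E (begin
    u * (i * i + 2 * i * r + i) + v * (i * i + i + 2 * i * r + 2 * r) + u * v
      ≡⟨ ring₁ i r u v ⟩
    u * (v + (i * i + i * r) + i * r + i) + v * (i * i + i + i * r + 2 * r + i * r)
      ≡⟨ cong₂ (λ x y → u * (x + i * r + i) + v * (y + i * r)) v-def (sym u-def) ⟩
    u * (r * r + r + i * r + i) + v * (u + r * r + i * r)
      ≡⟨ ring₂ i r u v ⟩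
    E + u * v ∎)
    where
    open ≡-Reasoning
    ring₁ : ∀ i r u v → u * (i * i + 2 * i * r + i) + v * (i * i + i + 2 * i * r + 2 * r) + u * v
                      ≡ u * (v + (i * i + i * r) + i * r + i) + v * (i * i + i + i * r + 2 * r + i * r)
    ring₁ = solve-∀
    ring₂ : ∀ i r u v → u * (r * r + r + i * r + i) + v * (u + r * r + i * r)
                      ≡ (u * suc r + v * r) * (i + r) + u * v
    ring₂ = solve-∀

  -- Twice the edges won by mixed over pure cliques; it is invariant under
  -- exchanging the two sides.
  gain : ℕ
  gain = u * (i * suc r) + v * (suc i * r)

  s-gain : s * (i + r) + gain ≡ E
  s-gain = trans (ring i r u v) balance
    where
    ring : ∀ i r u v → (u * i + v * suc i) * (i + r) + (u * (i * suc r) + v * (suc i * r))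
                     ≡ u * (i * i + 2 * i * r + i) + v * (i * i + i + 2 * i * r + 2 * r)
    ring = solve-∀

  -- This is the tile joined in the colour of the large side. By p(p - 1) + 2pq = p(p + q - 1) + pq
  -- each block splits into the pure share of its large part and a gain symmetric in both parts.
  l-gain : v * (r * r + 2 * r * i + r) + u * (r * r + r + 2 * r * i + 2 * i) ≡ E + gain
  l-gain = ring i r u v
    where
    ring : ∀ i r u v → v * (r * r + 2 * r * i + r) + u * (r * r + r + 2 * r * i + 2 * i)
                     ≡ (u * suc r + v * r) * (i + r) + (u * (i * suc r) + v * (suc i * r))
    ring = solve-∀

  s+l : s + l ≡ (u + v) * k
  s+l = trans (ring i r u v) (cong ((u + v) *_) k≡)
    where
    ring : ∀ i r u v → u * i + v * suc i + (u * suc r + v * r) ≡ (u + v) * suc (i + r)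
    ring = solve-∀

  s≤l : s ≤ l
  s≤l = *-cancelʳ-≤ s l (i + r) ⦃ >-nonZero i+r>0 ⦄ (≤-trans (m≤m+n _ gain) (≤-reflexive s-gain))

  u+v : u + v ≡ i + r + 2 * r
  u+v = +-cancelʳ-≡ (r * r + (i * i + i * r)) _ _ (begin
    u + v + (r * r + (i * i + i * r))             ≡⟨ ring₁ u v (r * r) (i * i + i * r) ⟩
    (u + r * r) + (v + (i * i + i * r))           ≡⟨ cong₂ _+_ u-def v-def ⟩
    (i * i + i + i * r + 2 * r) + (r * r + r)     ≡⟨ ring₂ i r ⟩
    i + r + 2 * r + (r * r + (i * i + i * r))     ∎)
    where
    open ≡-Reasoning
    ring₁ : ∀ u v x y → u + v + (x + y) ≡ (u + x) + (v + y)
    ring₁ = solve-∀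
    ring₂ : ∀ i r → (i * i + i + i * r + 2 * r) + (r * r + r) ≡ i + r + 2 * r + (r * r + (i * i + i * r))
    ring₂ = solve-∀

  u+v>0 : 0 < u + v
  u+v>0 = subst (0 <_) (sym u+v) (≤-trans i+r>0 (m≤m+n (i + r) (2 * r)))

  k>0 : 0 < k
  k>0 = subst (0 <_) k≡ (s≤s z≤n)

  s+l>0 : 0 < s + l
  s+l>0 = subst (0 <_) (sym s+l) (*-mono-≤ u+v>0 k>0)

  -- The summands of `threshold` are the sizes that `bipartite-ramsey` asks of its two cliques for
  -- sides `k * s` and `k * l`; their sum serves a clique in either role.
  tileSize threshold : ℕ
  tileSize  = k * s + k * l
  threshold = (k * s + k * s) + 2 ^ (k * s + k * s) * (k * l)

  tileSize>0 : 0 < tileSize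
  tileSize>0 = subst (0 <_) (*-distribˡ-+ k s l) (*-mono-≤ k>0 s+l>0)

  -- The pools consist of cliques of size N = 2 N₀ (threshold + k), so that
  -- N₀ times the number of wasted vertices is at most 2 n for large n.
  cliqueSize : ℕ → ℕ
  cliqueSize N₀ = N₀ * (2 * (threshold + k))

  -- The share of the waste that does not grow with the number of cliques: an imbalance of at most
  -- one tile between the pools, and the vertices left when Ramsey's theorem no longer applies.
  waste : ℕ → ℕ
  waste N₀ = tileSize + 2 ^ (cliqueSize N₀ + cliqueSize N₀)

-- The inequality carried by `go` says that `v` is nonnegative. It holds at `i` = 0 and fails at `r`
-- = 0, so there is a step at which it holds for `i` but not for `suc i`. As `u` at `i` is minus the
-- value of `v` at `suc i`, the failure makes `u` nonnegative.
parameters : ∀ k → 2 ≤ k → Parameters k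
parameters (suc r) (s≤s 1≤r) = go r 0 refl z≤n
  where
  k = suc r
  go : ∀ r i → suc (i + r) ≡ k → i * i + i * r ≤ r * r + r → Parameters k
  go zero i eq le = ⊥-elim (bad i (suc-injective eq) le)
    where
    bad : ∀ i → i + 0 ≡ r → ¬ (i * i + i * 0 ≤ 0)
    bad zero    refl = λ _ → <⇒≱ 1≤r z≤n
    bad (suc i) _    ()
  go (suc r′) i eq le with suc i * suc i + suc i * r′ ≤? r′ * r′ + r′
  ... | yes le′ = go r′ (suc i) (trans (cong suc (sym (+-suc i r′))) eq) le′
  ... | no ¬le  = record
    { i = i ; r = suc r′
    ; u = (i * i + i + i * suc r′ + 2 * suc r′) ∸ suc r′ * suc r′
    ; v = (suc r′ * suc r′ + suc r′) ∸ (i * i + i * suc r′)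
    ; k≡ = eq
    ; i+r>0 = ≤-trans (s≤s z≤n) (m≤n+m (suc r′) i)
    ; u-def = m∸n+n≡m {n = suc r′ * suc r′} (linear (≰⇒≥ ¬le) (ring i r′))
    ; v-def = m∸n+n≡m le
    }
    where
    ring : ∀ i r → suc r * suc r + (suc i * suc i + suc i * r) ≡ i * i + i + i * suc r + 2 * suc r + (r * r + r)
    ring = solve-∀

-- A relation between two colour variables, so that the two colours of a tiling can exchange roles.
Opposite : Colour → Colour → Set
Opposite a b = b ≡ opposite a

Opposite-sym : ∀ {a b} → Opposite a b → Opposite b a
Opposite-sym {a} refl = sym (opposite-involutive a)

module Tiles {n k : ℕ} (c : Colouring n) (P : Parameters k) where

  open Parameters P
  open Packings c k public

  -- `b` is the colour of the large side. The packings are alternatives on the same vertices: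
  -- `major` serves when `b` wins alone, `total` when the better of both colours is taken.
  record TilePackings (a b : Colour) (T : List V) : Set where
    field
      {ta tb} : ℕ
      packA   : Packing a T ta
      packB   : Packing b T tb
      major   : k * E ≤ tb
      total   : 2 * (k * E) ≤ ta + tb

  -- Joined in `a`, the mixed copies for `a` and the pure ones for `b` both reach `k * E` by
  -- `balance`. Joined in `b`, the gain moves from `a` to `b`, leaving k(E - gain) and k(E + gain).
  -- The factor `k` in the side lengths lets pure copies fill each side.
  tile : ∀ {a b A B} → Opposite a b → Mono a A → Mono b B →
    length A ≡ k * s → length B ≡ k * l → Joined a A B ⊎ Joined b A B → TilePackings a b (A ++ B)
  tile {a} {b} {A} {B} refl mA mB lA lB (inj₁ j) = record
    { packA = mixed-packing k≡ (k * u) (k * v)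
                (trans lA (ring₁ k u v i (suc i))) (trans lB (ring₁ k u v (suc r) r)) mA mB j
    ; packB = packing-++ {s = 0} (packing-[] A) (pure-packing l {i + r} k≡ (trans lB (*-comm k l)) mB)
    ; major = ≤-reflexive (sym pure)
    ; total = ≤-reflexive (cong₂ _+_ (sym mixed) (trans (+-identityʳ _) (sym pure)))
    }
    where
    ring₁ : ∀ k u v x y → k * (u * x + v * y) ≡ k * u * x + k * v * y
    ring₁ = solve-∀
    ring₂ : ∀ k l x → l * (k * x) ≡ k * (l * x)
    ring₂ = solve-∀
    pure : l * (k * (i + r)) ≡ k * E
    pure = ring₂ k l (i + r)
    mixed : k * u * (i * i + 2 * i * r + i) + k * v * (i * i + i + 2 * i * r + 2 * r) ≡ k * E
    mixed = trans (sym (ring₁ k u v (i * i + 2 * i * r + i) (i * i + i + 2 * i * r + 2 * r))) (cong (k *_) balance)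
  tile {a} {b} {A} {B} ab mA mB lA lB (inj₂ j) = record
    { packA = packing-++ (pure-packing s {i + r} k≡ (trans lA (*-comm k s)) mA) (packing-[] B)
    ; packB = packing-↭ (↭.++-comm B A) (mixed-packing (trans (cong suc (+-comm r i)) k≡) (k * v) (k * u)
                (trans lB (ring₁ k u v (suc r) r)) (trans lA (ring₁ k u v i (suc i)))
                mB (subst (λ x → Mono x A) (Opposite-sym ab) mA) (joined-sym j))
    ; major = ≤-trans (*-monoʳ-≤ k (m≤m+n E gain)) (≤-reflexive (sym mixed))
    ; total = ≤-reflexive (sym (trans (cong (s * (k * (i + r)) + 0 +_) mixed) sum≡))
    }
    where
    ring₁ : ∀ k u v x y → k * (u * x + v * y) ≡ k * v * y + k * u * x
    ring₁ = solve-∀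
    mixed : k * v * (r * r + 2 * r * i + r) + k * u * (r * r + r + 2 * r * i + 2 * i) ≡ k * (E + gain)
    mixed = trans (sym (ring₁ k u v (r * r + r + 2 * r * i + 2 * i) (r * r + 2 * r * i + r)))
            (cong (k *_) (trans (+-comm (u * _) _) l-gain))
    ring₂ : ∀ k s x e g → s * (k * x) + 0 + k * (e + g) ≡ k * (s * x + g) + k * e
    ring₂ = solve-∀
    sum≡ : s * (k * (i + r)) + 0 + k * (E + gain) ≡ 2 * (k * E)
    sum≡ = trans (ring₂ k s (i + r) E gain)
           (trans (cong (λ t → k * t + k * E) s-gain) (cong (k * E +_) (sym (+-identityʳ _))))

-- Greedy tiling

module Greedy {n k : ℕ} (c : Colouring n) (P : Parameters k) where

  open Parameters P
  open Tiles c P public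

  -- Tiles shrink the cliques but keep their number `p`, so a pool without a clique of size
  -- `threshold` has at most `p * threshold` vertices.
  record Pool (a : Colour) (p : ℕ) (U : List V) : Set where
    constructor pool
    field
      cliques : List (List V)
      monos   : All (Mono a) cliques
      number  : length cliques ≡ p
      covers  : concat cliques ↭ U

  record LargeClique (a : Colour) (p N : ℕ) (U : List V) : Set where
    constructor largeClique
    field
      {A U′} : List V
      splits : U ↭ A ++ U′
      mono   : Mono a A
      large  : N ≤ length A
      refill : ∀ {A₂} → Mono a A₂ → Pool a p (A₂ ++ U′)

  largeClique-concat : ∀ {a N} css → All (Mono a) css → length css * N < length (concat css) →
    LargeClique a (length css) N (concat css)
  largeClique-concat {a} {N} (A ∷ css) (m ∷ ms) lt with N ≤? length A
  ... | yes N≤ = largeClique ↭-refl m N≤ (λ m₂ → pool (_ ∷ css) (m₂ ∷ ms) refl ↭-refl)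
  ... | no N≰ with largeClique-concat css ms
                     (+-cancelˡ-< (length A) _ _ (≤-<-trans (+-monoˡ-≤ _ (≰⇒≥ N≰)) (subst (_ <_) (length-++ A) lt)))
  ...   | largeClique {B} {U′} sp mB N≤ re = largeClique
    (↭-trans (↭.++⁺ˡ A sp) (↭.shifts A B)) mB N≤
    λ {B₂} m₂ → let pool ds ms′ num cov = re m₂
                in pool (A ∷ ds) (m ∷ ms′) (cong suc num) (↭-trans (↭.++⁺ˡ A cov) (↭.shifts A B₂))

  find-largeClique : ∀ {a p U} N → Pool a p U → p * N < length U → LargeClique a p N U
  find-largeClique N (pool css ms refl cov) lt
    with largeClique-concat css ms (subst (_ <_) (sym (↭-length cov)) lt)
  ... | largeClique sp m N≤ re = largeClique (↭-trans (↭-sym cov) sp) m N≤ re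

  record Step (a b : Colour) (p q : ℕ) (U W : List V) : Set where
    field
      {T U′ W′} : List V
      splits    : U ++ W ↭ T ++ (U′ ++ W′)
      length-T  : length T ≡ tileSize
      length-U  : length U ≡ k * s + length U′
      length-W  : length W ≡ k * l + length W′
      poolU     : Pool a p U′
      poolW     : Pool b q W′
      packings  : TilePackings a b T

  mono-↭ : ∀ {a A B} → A ↭ B → Mono a A → Mono a B
  mono-↭ = AllPairs-resp-↭ (λ {x} {y} p → trans (symmetric c y x) p)

  -- Either outcome of `bipartite-ramsey` is a tile, since `tile` accepts both joining colours and
  -- `k * s` vertices of the first clique are requested in both.
  step : ∀ {a b p q U W} → Opposite a b → Pool a p U → Pool b q W →
    p * threshold < length U → q * threshold < length W → Step a b p q U W
  step {a} {b} {p} {q} {U} {W} ab PU PW ltU ltW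
    with find-largeClique threshold PU ltU | find-largeClique threshold PW ltW
  ... | largeClique {A} {U₀} spU mA geA reU | largeClique {B} {W₀} spW mB geB reW =
    go (bipartite-ramsey {a} (k * s) (k * s) (k * l) A B (≤-trans (m≤m+n _ _) geA) (≤-trans (m≤n+m _ _) geB))
    where
    result : ∀ {d} → HasBiclique d A B (k * s) (k * l) →
      (∀ {A₁ B₁} → Joined d A₁ B₁ → Joined a A₁ B₁ ⊎ Joined b A₁ B₁) →
      Step a b p q U W
    result (biclique {A₁} {A₂} {B₁} {B₂} eA eB sA sB j) colour-of = record
      { splits   = ↭-trans (↭.++⁺ U↭ W↭) (++-interchange-↭ A₁ (A₂ ++ U₀) B₁ (B₂ ++ W₀))
      ; length-T = trans (length-++ A₁) (cong₂ _+_ sA sB)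
      ; length-U = trans (↭-length U↭) (trans (length-++ A₁) (cong (_+ length (A₂ ++ U₀)) sA))
      ; length-W = trans (↭-length W↭) (trans (length-++ B₁) (cong (_+ length (B₂ ++ W₀)) sB))
      ; poolU    = reU (proj₂ monosA)
      ; poolW    = reW (proj₂ monosB)
      ; packings = tile ab (proj₁ monosA) (proj₁ monosB) sA sB (colour-of j)
      }
      where
      U↭ : U ↭ A₁ ++ (A₂ ++ U₀)
      U↭ = ↭-trans spU (↭-trans (↭.++⁺ʳ U₀ eA) (↭.++-assoc A₁ A₂ U₀))
      W↭ : W ↭ B₁ ++ (B₂ ++ W₀)
      W↭ = ↭-trans spW (↭-trans (↭.++⁺ʳ W₀ eB) (↭.++-assoc B₁ B₂ W₀))
      monosA = mono-++⁻ A₁ (mono-↭ eA mA)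
      monosB = mono-++⁻ B₁ (mono-↭ eB mB)
    go : HasBiclique a A B (k * s) (k * l) ⊎ HasBiclique (opposite a) A B (k * s) (k * l) → Step a b p q U W
    go (inj₁ bc) = result bc inj₁
    go (inj₂ bc) = result bc (λ j → inj₂ (subst (λ d → Joined d _ _) (sym ab) j))

  -- E / (s + l) is twice the number of edges per vertex to be achieved, and
  -- L bounds the number of vertices that are wasted.
  record Single (a : Colour) (L : ℕ) (U : List V) : Set where
    constructor single
    field
      {t}   : ℕ
      pack  : Packing a U t
      bound : E * length U ≤ (s + l) * t + E * L

  -- Only the sum is controlled, since different tiles may favour different colours.
  record Both (a b : Colour) (L : ℕ) (U : List V) : Set where
    constructor both
    field
      {ta tb} : ℕ
      packA   : Packing a U ta
      packB   : Packing b U tb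
      bound   : 2 * E * length U ≤ (s + l) * (ta + tb) + 2 * E * L

  single-↭ : ∀ {a L U W} → U ↭ W → Single a L U → Single a L W
  single-↭ p (single pk bd) = single (packing-↭ p pk) (subst (λ t → E * t ≤ _) (↭-length p) bd)

  both-↭ : ∀ {a b L U W} → U ↭ W → Both a b L U → Both a b L W
  both-↭ p (both pa pb bd) = both (packing-↭ p pa) (packing-↭ p pb) (subst (λ t → 2 * E * t ≤ _) (↭-length p) bd)

  both-swap : ∀ {a b L U} → Both a b L U → Both b a L U
  both-swap {L = L} {U} (both {ta} {tb} pa pb bd) =
    both pb pa (subst (λ t → 2 * E * length U ≤ (s + l) * t + 2 * E * L) (+-comm ta tb) bd)

  both-wasted : ∀ {a b L U} → length U ≤ L → Both a b L U
  both-wasted le = both (packing-[] _) (packing-[] _) (≤-trans (*-monoʳ-≤ (2 * E) le) (m≤n+m _ _))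

  single-tile : ∀ {a b L T U} → length T ≡ tileSize → TilePackings a b T → Single b L U → Single b L (T ++ U)
  single-tile {L = L} {T} {U} len TP (single {t} pk bd) = single (packing-++ packB pk)
    (begin
      E * length (T ++ U)            ≡⟨ cong (E *_) (trans (length-++ T) (cong (_+ length U) len)) ⟩
      E * (tileSize + length U)      ≡⟨ ring₁ E k s l (length U) ⟩
      (s + l) * (k * E) + E * length U ≤⟨ +-mono-≤ (*-monoʳ-≤ (s + l) major) bd ⟩
      (s + l) * tb + ((s + l) * t + E * L) ≡⟨ ring₂ (s + l) tb t (E * L) ⟩
      (s + l) * (tb + t) + E * L ∎)
    where
    open TilePackings TP
    open ≤-Reasoning
    ring₁ : ∀ E k s l x → E * (k * s + k * l + x) ≡ (s + l) * (k * E) + E * x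
    ring₁ = solve-∀
    ring₂ : ∀ y t t′ x → y * t + (y * t′ + x) ≡ y * (t + t′) + x
    ring₂ = solve-∀

  both-tile : ∀ {a b L T U} → length T ≡ tileSize → TilePackings a b T → Both a b L U → Both a b L (T ++ U)
  both-tile {L = L} {T} {U} len TP (both {ta′} {tb′} pa pb bd) = both (packing-++ packA pa) (packing-++ packB pb)
    (begin
      2 * E * length (T ++ U)            ≡⟨ cong (2 * E *_) (trans (length-++ T) (cong (_+ length U) len)) ⟩
      2 * E * (tileSize + length U)      ≡⟨ ring₁ E k s l (length U) ⟩
      (s + l) * (2 * (k * E)) + 2 * E * length U ≤⟨ +-mono-≤ (*-monoʳ-≤ (s + l) total) bd ⟩
      (s + l) * (ta + tb) + ((s + l) * (ta′ + tb′) + 2 * E * L) ≡⟨ ring₂ (s + l) ta tb ta′ tb′ (2 * E * L) ⟩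
      (s + l) * (ta + ta′ + (tb + tb′)) + 2 * E * L ∎)
    where
    open TilePackings TP
    open ≤-Reasoning
    ring₁ : ∀ E k s l x → 2 * E * (k * s + k * l + x) ≡ (s + l) * (2 * (k * E)) + 2 * E * x
    ring₁ = solve-∀
    ring₂ : ∀ y t u t′ u′ x → y * (t + u) + (y * (t′ + u′) + x) ≡ y * (t + t′ + (u + u′)) + x
    ring₂ = solve-∀

  -- The smaller pool always gives the small side. A tile changes the difference of the lengths by
  -- `k * l - k * s`, so the pools stay within one tile of each other if roles are exchanged
  -- whenever the order flips. Once either pool is too small for a further tile, the other is small
  -- as well and all that is left is waste. `f` bounds the number of vertices left.
  balanced : ∀ f {a b p q L U W} → Opposite a b → Pool a p U → Pool b q W →
    2 * (p * threshold) + tileSize ≤ L → 2 * (q * threshold) + tileSize ≤ L →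
    length U ≤ length W → length W ≤ length U + tileSize → length U + length W ≤ f →
    Both a b L (U ++ W)
  balanced f {a} {b} {p} {q} {L} {U} {W} ab PU PW hp hq U≤W W≤U+ fuel
    with length U ≤? p * threshold | length W ≤? q * threshold
  ... | yes small | _ = both-wasted (begin
      length (U ++ W)                        ≡⟨ length-++ U ⟩
      length U + length W                    ≤⟨ +-mono-≤ small (≤-trans W≤U+ (+-monoˡ-≤ tileSize small)) ⟩
      p * threshold + (p * threshold + tileSize) ≡⟨ ring (p * threshold) tileSize ⟩
      2 * (p * threshold) + tileSize         ≤⟨ hp ⟩
      L ∎)
    where
    open ≤-Reasoning
    ring : ∀ x y → x + (x + y) ≡ 2 * x + y
    ring = solve-∀
  ... | no _ | yes small = both-wasted (begin
      length (U ++ W)                        ≡⟨ length-++ U ⟩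
      length U + length W                    ≤⟨ +-mono-≤ (≤-trans U≤W small) small ⟩
      q * threshold + q * threshold          ≡⟨ ring (q * threshold) ⟩
      2 * (q * threshold)                    ≤⟨ m≤m+n _ tileSize ⟩
      2 * (q * threshold) + tileSize         ≤⟨ hq ⟩
      L ∎)
    where
    open ≤-Reasoning
    ring : ∀ x → x + x ≡ 2 * x
    ring = solve-∀
  balanced zero ab PU PW hp hq U≤W W≤U+ fuel | no U-big | no _ =
    ⊥-elim (U-big (≤-trans (≤-trans (m≤m+n _ _) fuel) z≤n))
  balanced (suc f) {L = L} {U = U} {W} ab PU PW hp hq U≤W W≤U+ fuel | no U-big | no W-big
    with step ab PU PW (≰⇒> U-big) (≰⇒> W-big)
  ... | st = both-↭ (↭-sym splits) (both-tile length-T packings next)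
    where
    open Step st
    x = length U′
    y = length W′
    sizes′ : k * s + x + (k * l + y) ≤ suc f
    sizes′ = subst₂ (λ t t′ → t + t′ ≤ suc f) length-U length-W fuel
    fuel′ : x + y ≤ f
    fuel′ = s≤s⁻¹ (linear (+-mono-≤ tileSize>0 sizes′) (ring x y f (k * s) (k * l)))
      where
      ring : ∀ x y f S T → suc (x + y) + (S + T + suc f) ≡ suc f + suc (S + x + (T + y))
      ring = solve-∀
    U≤W′ : k * s + x ≤ k * l + y
    U≤W′ = subst₂ _≤_ length-U length-W U≤W
    W≤U+′ : k * l + y ≤ k * s + x + tileSize
    W≤U+′ = subst₂ (λ t t′ → t ≤ t′ + tileSize) length-W length-U W≤U+
    next : Both _ _ L (U′ ++ W′)
    next with x ≤? y
    ... | yes x≤y = balanced f ab poolU poolW hp hq x≤y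
          (linear (+-mono-≤ W≤U+′ (*-monoʳ-≤ k s≤l)) (ring x y (k * s) (k * l)))
          fuel′
      where
      ring : ∀ x y S T → y + (S + x + (S + T) + T) ≡ x + (S + T) + (T + y + S)
      ring = solve-∀
    ... | no x≰y = both-swap (both-↭ (↭.++-comm W′ U′)
          (balanced f (Opposite-sym ab) poolW poolU hq hp (≰⇒≥ x≰y)
            (linear (+-mono-≤ U≤W′ (z≤n {k * s + k * s})) (ring x y (k * s) (k * l)))
            (subst (_≤ f) (+-comm x y) fuel′)))
      where
      ring : ∀ x y S T → x + (T + y + (S + S)) ≡ y + (S + T) + (S + x + 0)
      ring = solve-∀

  private instance
    k≢0 : NonZero k
    k≢0 = >-nonZero k>0

  pure-list : ∀ {a A} → Mono a A → ∃[ t ] (Packing a A t × length A * (i + r) ≤ t + k * (i + r))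
  pure-list {a} {A} mA
    with split-at (length A / k * k) A (trans (m≡m%n+[m/n]*n (length A) k) (+-comm (length A % k) _))
  ... | A₁ , A₂ , refl , lA₁ , lA₂ =
    q * (k * (i + r))
    , packing-≤ (m≤m+n _ 0) (packing-++ (pure-packing q {i + r} k≡ lA₁ (proj₁ (mono-++⁻ A₁ mA))) (packing-[] A₂))
    , (begin
      length (A₁ ++ A₂) * (i + r)       ≡⟨ cong (_* (i + r)) (m≡m%n+[m/n]*n (length (A₁ ++ A₂)) k) ⟩
      (length (A₁ ++ A₂) % k + q * k) * (i + r) ≤⟨ *-monoˡ-≤ (i + r) (+-monoˡ-≤ (q * k) (m%n≤n (length (A₁ ++ A₂)) k)) ⟩
      (k + q * k) * (i + r)             ≡⟨ ring k q (i + r) ⟩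
      q * (k * (i + r)) + k * (i + r)   ∎)
    where
    open ≤-Reasoning
    q : ℕ
    q = length (A₁ ++ A₂) / k
    ring : ∀ k q x → (k + q * k) * x ≡ q * (k * x) + k * x
    ring = solve-∀

  pure-pool : ∀ {a q W} → Pool a q W → ∃[ t ] (Packing a W t × length W * (i + r) ≤ t + q * (k * (i + r)))
  pure-pool (pool css ms refl cov) =
    let t , pk , bd = go css ms
    in t , packing-↭ cov pk ,
       subst (λ m → m * (i + r) ≤ t + length css * (k * (i + r))) (↭-length cov) bd
    where
    go : ∀ {a} css → All (Mono a) css →
         ∃[ t ] (Packing a (concat css) t × length (concat css) * (i + r) ≤ t + length css * (k * (i + r)))
    go []        []       = 0 , packing-[] [] , z≤n
    go (A ∷ css) (m ∷ ms) =
      let t , pk , bd = pure-list m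
          t′ , pk′ , bd′ = go css ms
      in t + t′ , packing-++ pk pk′ ,
         subst₂ _≤_ (sym (trans (cong (_* (i + r)) (length-++ A)) (*-distribʳ-+ (i + r) (length A) _)))
           (ring t t′ (k * (i + r)) (length css * (k * (i + r)))) (+-mono-≤ bd bd′)
      where
      ring : ∀ t t′ x y → t + x + (t′ + y) ≡ t + t′ + (x + y)
      ring = solve-∀

  -- Counted twice, pure cliques have `i + r` edges per vertex, while the target is `l * (i + r)`
  -- per `s + l` vertices. So `W` meets it alone; `U` and the remainders modulo `k` of the cliques
  -- in `W` are waste.
  single-pure : ∀ {b p q L U W} → Pool b q W → length U ≤ p * threshold → q * k + p * threshold ≤ L →
    Single b L (U ++ W)
  single-pure {b} {p} {q} {L} {U} {W} PW small hL with pure-pool PW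
  ... | t , pk , bd = single (packing-++ (packing-[] U) pk) (begin
      E * length (U ++ W)                             ≡⟨ cong (E *_) (length-++ U) ⟩
      E * (length U + length W)                       ≡⟨ ring₁ l (i + r) (length U) (length W) ⟩
      l * (length W * (i + r)) + E * length U         ≤⟨ +-mono-≤ (*-monoʳ-≤ l bd) (*-monoʳ-≤ E small) ⟩
      l * (t + q * (k * (i + r))) + E * (p * threshold) ≡⟨ ring₂ l (i + r) t q k (p * threshold) ⟩
      l * t + E * (q * k + p * threshold)             ≤⟨ +-mono-≤ (*-monoˡ-≤ t (m≤n+m l s)) (*-monoʳ-≤ E hL) ⟩
      (s + l) * t + E * L                             ∎)
    where
    open ≤-Reasoning
    ring₁ : ∀ l y u w → l * y * (u + w) ≡ l * (w * y) + l * y * u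
    ring₁ = solve-∀
    ring₂ : ∀ l y t q k z → l * (t + q * (k * y)) + l * y * z ≡ l * t + l * y * (q * k + z)
    ring₂ = solve-∀

  -- While `U` stays the smaller pool, `b` has the large side of every tile. If `U` runs out,
  -- `major` and a pure packing of the remaining `W` let `b` win. At the first change of order the
  -- pools are within one tile of each other, so `balanced` takes over and `total` accounts for the
  -- earlier tiles.
  greedy : ∀ f {a b p q L U W} → Opposite a b → Pool a p U → Pool b q W →
    2 * (p * threshold) + tileSize ≤ L → 2 * (q * threshold) + tileSize ≤ L → q * k + p * threshold ≤ L →
    length U ≤ length W → length U + length W ≤ f →
    Single b L (U ++ W) ⊎ Both a b L (U ++ W)
  greedy f {a} {b} {p} {q} {L} {U} {W} ab PU PW hp hq hL U≤W fuel
    with length U ≤? p * threshold | length W ≤? q * threshold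
  ... | yes small | _ = inj₁ (single-pure {p = p} PW small hL)
  ... | no _ | yes small = inj₂ (both-wasted (begin
      length (U ++ W)                        ≡⟨ length-++ U ⟩
      length U + length W                    ≤⟨ +-mono-≤ (≤-trans U≤W small) small ⟩
      q * threshold + q * threshold          ≡⟨ ring (q * threshold) ⟩
      2 * (q * threshold)                    ≤⟨ m≤m+n _ tileSize ⟩
      2 * (q * threshold) + tileSize         ≤⟨ hq ⟩
      L ∎))
    where
    open ≤-Reasoning
    ring : ∀ x → x + x ≡ 2 * x
    ring = solve-∀
  greedy zero ab PU PW hp hq hL U≤W fuel | no U-big | no _ =
    ⊥-elim (U-big (≤-trans (≤-trans (m≤m+n _ _) fuel) z≤n))
  greedy (suc f) {L = L} {U = U} {W} ab PU PW hp hq hL U≤W fuel | no U-big | no W-big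
    with step ab PU PW (≰⇒> U-big) (≰⇒> W-big)
  ... | st = next
    where
    open Step st
    x = length U′
    y = length W′
    sizes′ : k * s + x + (k * l + y) ≤ suc f
    sizes′ = subst₂ (λ t t′ → t + t′ ≤ suc f) length-U length-W fuel
    fuel′ : x + y ≤ f
    fuel′ = s≤s⁻¹ (linear (+-mono-≤ tileSize>0 sizes′) (ring x y f (k * s) (k * l)))
      where
      ring : ∀ x y f S T → suc (x + y) + (S + T + suc f) ≡ suc f + suc (S + x + (T + y))
      ring = solve-∀
    U≤W′ : k * s + x ≤ k * l + y
    U≤W′ = subst₂ _≤_ length-U length-W U≤W
    next : Single _ L (U ++ W) ⊎ Both _ _ L (U ++ W)
    next with x ≤? y
    ... | yes x≤y with greedy f ab poolU poolW hp hq hL x≤y fuel′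
    ...   | inj₁ sg = inj₁ (single-↭ (↭-sym splits) (single-tile length-T packings sg))
    ...   | inj₂ bt = inj₂ (both-↭ (↭-sym splits) (both-tile length-T packings bt))
    next | no x≰y = inj₂ (both-↭ (↭-sym splits) (both-tile length-T packings
          (both-swap (both-↭ (↭.++-comm W′ U′)
          (balanced f (Opposite-sym ab) poolW poolU hq hp (≰⇒≥ x≰y)
            (linear (+-mono-≤ U≤W′ (z≤n {k * s + k * s})) (ring x y (k * s) (k * l)))
            (subst (_≤ f) (+-comm x y) fuel′))))))
      where
      ring : ∀ x y S T → x + (T + y + (S + S)) ≡ y + (S + T) + (S + x + 0)
      ring = solve-∀

-- From tilings to factors

module Conclusion {n k : ℕ} (c : Colouring n) (P : Parameters k) where

  open Parameters P
  open Greedy c P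

  record CliqueDecomposition (N : ℕ) (U : List V) : Set where
    field
      {p q}        : ℕ
      {R S Z}      : List V
      splits       : U ↭ (R ++ S) ++ Z
      reds         : Pool red p R
      blues        : Pool blue q S
      length-reds  : length R ≡ p * N
      length-blues : length S ≡ q * N
      few-left     : length Z ≤ 2 ^ (N + N)

  pool-∷ : ∀ {a p U A} → Mono a A → Pool a p U → Pool a (suc p) (A ++ U)
  pool-∷ {A = A} m (pool css ms num cov) = pool (A ∷ css) (m ∷ ms) (cong suc num) (↭.++⁺ˡ A cov)

  decompose : ∀ N → 0 < N → ∀ f U → length U ≤ f → CliqueDecomposition N U
  decompose N N>0 f U fuel with 2 ^ (N + N) ≤? length U
  ... | no ¬le = record
    { splits = ↭-refl ; reds = pool [] [] refl ↭-refl ; blues = pool [] [] refl ↭-refl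
    ; length-reds = refl ; length-blues = refl ; few-left = ≰⇒≥ ¬le }
  decompose N N>0 zero U fuel | yes le = ⊥-elim (<⇒≱ (m^n>0 2 (N + N)) (≤-trans le fuel))
  decompose N N>0 (suc f) U fuel | yes le with ramsey {red} N N U le
  ... | inj₁ (clique {C} {O} sp len m) = record
    { splits = ↭-trans sp (↭-trans (↭.++⁺ˡ C splits)
        (↭-reflexive (trans (sym (++-assoc C (R ++ S) Z)) (cong (_++ Z) (sym (++-assoc C R S))))))
    ; reds = pool-∷ m reds ; blues = blues
    ; length-reds = trans (length-++ C) (cong₂ _+_ len length-reds) ; length-blues = length-blues ; few-left = few-left }
    where
    rest = decompose N N>0 f O (s≤s⁻¹ (≤-trans (+-monoˡ-≤ (length O) N>0)
             (subst (_≤ suc f) (trans (↭-length sp) (trans (length-++ C) (cong (_+ length O) len))) fuel)))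
    open CliqueDecomposition rest
  ... | inj₂ (clique {C} {O} sp len m) = record
    { splits = ↭-trans sp (↭-trans (↭.++⁺ˡ C splits)
        (↭-trans (↭-reflexive (sym (++-assoc C (R ++ S) Z))) (↭.++⁺ʳ Z (↭.shifts C R))))
    ; reds = reds ; blues = pool-∷ m blues
    ; length-reds = length-reds ; length-blues = trans (length-++ C) (cong₂ _+_ len length-blues) ; few-left = few-left }
    where
    rest = decompose N N>0 f O (s≤s⁻¹ (≤-trans (+-monoˡ-≤ (length O) N>0)
             (subst (_≤ suc f) (trans (↭-length sp) (trans (length-++ C) (cong (_+ length O) len))) fuel)))
    open CliqueDecomposition rest

  single-waste : ∀ {a L L′ U Z} → length Z ≤ L′ → Single a L U → Single a (L + L′) (U ++ Z)
  single-waste {L = L} {L′} {U} {Z} le (single {t} pk bd) = single (packing-++ pk (packing-[] Z)) (begin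
      E * length (U ++ Z)             ≡⟨ cong (E *_) (length-++ U) ⟩
      E * (length U + length Z)       ≡⟨ *-distribˡ-+ E (length U) (length Z) ⟩
      E * length U + E * length Z     ≤⟨ +-mono-≤ bd (*-monoʳ-≤ E le) ⟩
      (s + l) * t + E * L + E * L′    ≡⟨ ring (s + l) t E L L′ ⟩
      (s + l) * (t + 0) + E * (L + L′) ∎)
    where
    open ≤-Reasoning
    ring : ∀ x t E L L′ → x * t + E * L + E * L′ ≡ x * (t + 0) + E * (L + L′)
    ring = solve-∀

  both⇒single : ∀ {a b L U} → Both a b L U → ∃[ d ] Single d L U
  both⇒single {a} {b} {L} {U} (both {ta} {tb} pa pb bd) with ≤-total ta tb
  ... | inj₁ ta≤tb = b , single pb (*-cancelˡ-≤ 2 (≤-trans (≤-reflexive (sym (*-assoc 2 E (length U))))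
          (≤-trans bd (≤-trans (+-monoˡ-≤ (2 * E * L) (*-monoʳ-≤ (s + l) (+-monoˡ-≤ tb ta≤tb)))
            (≤-reflexive (ring (s + l) tb E L))))))
    where
    ring : ∀ x t E L → x * (t + t) + 2 * E * L ≡ 2 * (x * t + E * L)
    ring = solve-∀
  ... | inj₂ tb≤ta = a , single pa (*-cancelˡ-≤ 2 (≤-trans (≤-reflexive (sym (*-assoc 2 E (length U))))
          (≤-trans bd (≤-trans (+-monoˡ-≤ (2 * E * L) (*-monoʳ-≤ (s + l) (+-monoʳ-≤ ta tb≤ta)))
            (≤-reflexive (ring (s + l) ta E L))))))
    where
    ring : ∀ x t E L → x * (t + t) + 2 * E * L ≡ 2 * (x * t + E * L)
    ring = solve-∀

  good-packing : ∀ N₀ → 0 < N₀ → ∀ U → ∃[ L ] (N₀ * L ≤ length U + N₀ * waste N₀ × ∃[ d ] Single d L U)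
  good-packing N₀ N₀>0 U = L , N₀L≤ , choose (≤-total (length R) (length S))
    where
    N = cliqueSize N₀
    N>0 : 0 < N
    N>0 = *-mono-≤ N₀>0 (*-mono-≤ {1} {2} (s≤s z≤n) (≤-trans k>0 (m≤n+m k threshold)))
    open CliqueDecomposition (decompose N N>0 (length U) U ≤-refl)
    -- `L₁` dominates the three waste bounds of `greedy` for either order of the pools, and `L₂`
    -- bounds `Z`. Each clique has `N₀ * (2 * (threshold + k))` vertices, so `N₀` times the first
    -- term of `L₁` is the total length of the pools.
    L₁ L₂ L : ℕ
    L₁ = (p + q) * (2 * (threshold + k)) + tileSize
    L₂ = 2 ^ (N + N)
    L  = L₁ + L₂
    N₀L≤ : N₀ * L ≤ length U + N₀ * waste N₀
    N₀L≤ = begin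
      N₀ * L                                          ≡⟨ ring N₀ p q (2 * (threshold + k)) tileSize L₂ ⟩
      (p * N + q * N) + N₀ * waste N₀
        ≡⟨ cong (_+ N₀ * waste N₀) (cong₂ _+_ (sym length-reds) (sym length-blues)) ⟩
      (length R + length S) + N₀ * waste N₀           ≤⟨ +-monoˡ-≤ (N₀ * waste N₀) (m≤m+n _ (length Z)) ⟩
      (length R + length S + length Z) + N₀ * waste N₀
        ≡⟨ cong (_+ N₀ * waste N₀) (sym (trans (↭-length splits)
            (trans (length-++ (R ++ S)) (cong (_+ length Z) (length-++ R))))) ⟩
      length U + N₀ * waste N₀                        ∎
      where
      open ≤-Reasoning
      ring : ∀ N₀ p q x T y → N₀ * ((p + q) * x + T + y) ≡ (p * (N₀ * x) + q * (N₀ * x)) + N₀ * (T + y)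
      ring = solve-∀
    hp : 2 * (p * threshold) + tileSize ≤ L₁
    hp = linear (z≤n {2 * p * k + q * (2 * (threshold + k))}) (ring p q threshold k tileSize)
      where
      ring : ∀ p q M k T → 2 * (p * M) + T + (2 * p * k + q * (2 * (M + k))) ≡ (p + q) * (2 * (M + k)) + T + 0
      ring = solve-∀
    hq : 2 * (q * threshold) + tileSize ≤ L₁
    hq = linear (z≤n {2 * q * k + p * (2 * (threshold + k))}) (ring p q threshold k tileSize)
      where
      ring : ∀ p q M k T → 2 * (q * M) + T + (2 * q * k + p * (2 * (M + k))) ≡ (p + q) * (2 * (M + k)) + T + 0
      ring = solve-∀
    h : ∀ p q → q * k + p * threshold ≤ (p + q) * (2 * (threshold + k)) + tileSize
    h p q = linear (z≤n {(p + q) * (threshold + k) + p * k + q * threshold + tileSize}) (ring p q threshold k tileSize)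
      where
      ring : ∀ p q M k T → q * k + p * M + ((p + q) * (M + k) + p * k + q * M + T) ≡ (p + q) * (2 * (M + k)) + T + 0
      ring = solve-∀
    finish : ∀ {a b W} → W ++ Z ↭ U → Single b L₁ W ⊎ Both a b L₁ W → ∃[ d ] Single d L U
    finish perm (inj₁ sg) = _ , single-↭ perm (single-waste few-left sg)
    finish perm (inj₂ bt) = let d , sg = both⇒single bt in d , single-↭ perm (single-waste few-left sg)
    choose : length R ≤ length S ⊎ length S ≤ length R → ∃[ d ] Single d L U
    choose (inj₁ R≤S) = finish (↭-sym splits) (greedy _ refl reds blues hp hq (h p q) R≤S ≤-refl)
    choose (inj₂ S≤R) = finish (↭-trans (↭.++⁺ʳ Z (↭.++-comm S R)) (↭-sym splits))
      (greedy _ refl blues reds hq hp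
        (subst (λ m → p * k + q * threshold ≤ m * (2 * (threshold + k)) + tileSize) (+-comm q p) (h q p)) S≤R ≤-refl)

  chunks : ∀ {A : Set} m (xs : List A) → length xs ≡ m * k →
    ∃[ css ] (All (λ ys → length ys ≡ k) css × concat css ≡ xs)
  chunks zero    []  eq = [] , [] , refl
  chunks (suc m) xs eq with split-at k xs eq
  ... | ys , zs , refl , len , len′ =
    let css , ss , cov = chunks m zs len′ in ys ∷ css , len ∷ ss , cong (ys ++_) cov

  length-concat : ∀ {A : Set} {css : List (List A)} → All (λ ys → length ys ≡ k) css →
    length (concat css) ≡ length css * k
  length-concat []                      = refl
  length-concat {css = ys ∷ _} (p ∷ ps) = trans (length-++ ys) (cong₂ _+_ p (length-concat ps))

  -- The number of uncovered vertices is a multiple of `k`, like `n` and the covered part. They are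
  -- cut into arbitrary further copies, which can only add edges.
  packing⇒factor : ∀ {a t} → k ∣ n → Packing a (allFin n) t → ∃[ F ] (t ≤ 2 * edgesOfColour {k} c a F)
  packing⇒factor {a} {t} (divides m n≡) (packing bs rs si co ct) =
    toFactor part , ≤-trans ct (*-monoʳ-≤ 2 (subst (∑ (edgeCount a) bs ≤_)
      (sym (trans (edgesOfColour-toFactor part c a) (∑-++ (edgeCount a) bs _))) (m≤m+n _ _)))
    where
    length-rs : length rs ≡ (m ∸ length bs) * k
    length-rs = begin
      length rs                                  ≡⟨ sym (m+n∸m≡n (length bs * k) (length rs)) ⟩
      length bs * k + length rs ∸ length bs * k
        ≡⟨ cong (_∸ length bs * k) (cong (_+ length rs) (sym (length-concat si))) ⟩
      length (concat bs) + length rs ∸ length bs * k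
        ≡⟨ cong (_∸ length bs * k) (trans (sym (length-++ (concat bs)))
          (trans (↭-length co) (trans (length-tabulate id) n≡))) ⟩
      m * k ∸ length bs * k                      ≡⟨ sym (*-distribʳ-∸ k m (length bs)) ⟩
      (m ∸ length bs) * k                        ∎
      where open ≡-Reasoning
    chunked = chunks (m ∸ length bs) rs length-rs
    part : Partition n k
    part = record
      { blocks = bs ++ proj₁ chunked
      ; sizes  = All.++⁺ si (proj₁ (proj₂ chunked))
      ; covers = ↭-trans (↭-reflexive (trans (sym (concat-++ bs (proj₁ chunked)))
                  (cong (concat bs ++_) (proj₂ (proj₂ chunked))))) co
      }

many-edges : ∀ {k} (P : Parameters k) → let open Parameters P in
  ∀ N₀ → 0 < N₀ → ∃[ n₀ ] (∀ n → n₀ ≤ n → k ∣ n → ∀ (c : Colouring n) →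
    ∃[ F ] ∃[ a ] (N₀ * (E * n) ≤ N₀ * ((s + l) * (2 * edgesOfColour {k} c a F)) + E * (2 * n)))
-- With this `n₀` the fixed share of the waste is absorbed: `N₀ * L` is at most `n + n₀`, hence at
-- most `2 * n`.
many-edges {k} P N₀ N₀>0 = N₀ * waste N₀ , λ n n≥ k∣n c →
  let open Conclusion c P
      L , N₀L≤ , d , sg = good-packing N₀ N₀>0 (allFin n)
      open Greedy c P
      open Single sg
      F , t≤ = packing⇒factor k∣n pack
  in F , d , (begin
      N₀ * (E * n)                              ≡⟨ cong (λ m → N₀ * (E * m)) (sym (length-tabulate {n = n} id)) ⟩
      N₀ * (E * length (allFin n))              ≤⟨ *-monoʳ-≤ N₀ bound ⟩
      N₀ * ((s + l) * t + E * L)                ≤⟨ *-monoʳ-≤ N₀ (+-monoˡ-≤ (E * L) (*-monoʳ-≤ (s + l) t≤)) ⟩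
      N₀ * ((s + l) * (2 * edgesOfColour c d F) + E * L) ≡⟨ ring N₀ ((s + l) * (2 * edgesOfColour c d F)) E L ⟩
      N₀ * ((s + l) * (2 * edgesOfColour c d F)) + E * (N₀ * L)
        ≤⟨ +-monoʳ-≤ _ (*-monoʳ-≤ E (≤-trans N₀L≤ (+-monoʳ-≤ (length (allFin n)) n≥))) ⟩
      N₀ * ((s + l) * (2 * edgesOfColour c d F)) + E * (length (allFin n) + n)
        ≡⟨ cong (λ m → N₀ * ((s + l) * (2 * edgesOfColour c d F)) + E * m)
            (trans (cong (_+ n) (length-tabulate {n = n} id)) (cong (n +_) (sym (+-identityʳ n)))) ⟩
      N₀ * ((s + l) * (2 * edgesOfColour c d F)) + E * (2 * n) ∎)
  where
  open Parameters P
  open ≤-Reasoning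
  ring : ∀ N x E L → N * (x + E * L) ≡ N * x + E * (N * L)
  ring = solve-∀

-- Rational and real estimates

private
  -- Over unnormalised rationals no reduction to lowest terms intervenes, and the laws for `natℚ`
  -- become integer identities.
  natᵘ : ℕ → ℚᵘ.ℚᵘ
  natᵘ n = ℚᵘ.mkℚᵘ (ℤ.+ n) 0

  toℚᵘ-natℚ : ∀ n → ℚ.toℚᵘ (natℚ n) ℚᵘ.≃ natᵘ n
  toℚᵘ-natℚ n = ℚ.toℚᵘ-fromℚᵘ (natᵘ n)

natℚ-+ : ∀ m n → natℚ (m + n) ≡ natℚ m ℚ.+ natℚ n
natℚ-+ m n = ℚ.toℚᵘ-injective (ℚᵘ.≃-trans (toℚᵘ-natℚ (m + n))
  (ℚᵘ.≃-trans (ℚᵘ.*≡* (ring (ℤ.+ m) (ℤ.+ n)))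
  (ℚᵘ.≃-sym (ℚᵘ.≃-trans (ℚ.toℚᵘ-homo-+ (natℚ m) (natℚ n))
    (ℚᵘ.+-cong (toℚᵘ-natℚ m) (toℚᵘ-natℚ n))))))
  where
  ring : ∀ a b → (a ℤ.+ b) ℤ.* ℤ.1ℤ ≡ (a ℤ.* ℤ.1ℤ ℤ.+ b ℤ.* ℤ.1ℤ) ℤ.* ℤ.1ℤ
  ring = ℤ.solve-∀

natℚ-* : ∀ m n → natℚ (m * n) ≡ natℚ m ℚ.* natℚ n
natℚ-* m n = ℚ.toℚᵘ-injective (ℚᵘ.≃-trans (toℚᵘ-natℚ (m * n))
  (ℚᵘ.≃-trans (ℚᵘ.*≡* (cong (ℤ._* ℤ.1ℤ) (ℤ.pos-* m n)))
  (ℚᵘ.≃-sym (ℚᵘ.≃-trans (ℚ.toℚᵘ-homo-* (natℚ m) (natℚ n))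
    (ℚᵘ.*-cong (toℚᵘ-natℚ m) (toℚᵘ-natℚ n))))))

natℚ-mono : ∀ {m n} → m ≤ n → natℚ m ℚ.≤ natℚ n
natℚ-mono {m} {n} m≤n = ℚ.toℚᵘ-cancel-≤ (ℚᵘ.≤-trans (ℚᵘ.≤-reflexive (toℚᵘ-natℚ m))
  (ℚᵘ.≤-trans (ℚᵘ.*≤* (ℤ.*-monoʳ-≤-nonNeg ℤ.1ℤ (ℤ.+≤+ m≤n)))
    (ℚᵘ.≤-reflexive (ℚᵘ.≃-sym (toℚᵘ-natℚ n)))))

natℚ-nonNeg : ∀ n → ℚ.NonNegative (natℚ n)
natℚ-nonNeg n = ℚ.nonNegative (natℚ-mono {0} {n} z≤n)

natℚ-pos : ∀ {n} → 0 < n → ℚ.Positive (natℚ n)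
natℚ-pos {n} 0<n = ℚ.positive (ℚ.<-≤-trans (ℚ.positive⁻¹ 1ℚ) (natℚ-mono 0<n))

natℚ-*-/ : ∀ e d .{{_ : NonZero d}} → natℚ d ℚ.* (ℤ.+ e ℚ./ d) ≡ natℚ e
natℚ-*-/ e (suc d) = ℚ.toℚᵘ-injective (ℚᵘ.≃-trans (ℚ.toℚᵘ-homo-* (natℚ (suc d)) (ℤ.+ e ℚ./ suc d))
  (ℚᵘ.≃-trans (ℚᵘ.*-cong (toℚᵘ-natℚ (suc d)) (ℚ.toℚᵘ-fromℚᵘ (ℚᵘ.mkℚᵘ (ℤ.+ e) d)))
  (ℚᵘ.≃-trans (ℚᵘ.*≡* (trans (ring ℤ.+[1+ d ] (ℤ.+ e))
    (cong (λ x → ℤ.+ e ℤ.* ℤ.+[1+ x ]) (sym (+-identityʳ d)))))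
    (ℚᵘ.≃-sym (toℚᵘ-natℚ e)))))
  where
  ring : ∀ a b → a ℤ.* b ℤ.* ℤ.1ℤ ≡ b ℤ.* a
  ring = ℤ.solve-∀

≤-natℚ-* : ∀ {n p} → 0 < n → 0ℚ ℚ.≤ p → p ℚ.≤ natℚ n ℚ.* p
≤-natℚ-* {n} {p} 0<n 0≤p = subst (ℚ._≤ natℚ n ℚ.* p) (ℚ.*-identityˡ p)
  (ℚ.*-monoʳ-≤-nonNeg p ⦃ ℚ.nonNegative 0≤p ⦄ (natℚ-mono 0<n))

archimedean : ∀ e {η} → 0ℚ ℚ.< η → ∃[ N ] (0 < N × natℚ e ℚ.≤ natℚ N ℚ.* η)
archimedean e {mkℚ ℤ.-[1+ _ ] _ _} 0<η with () ← ℚ.positive 0<η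
archimedean e {mkℚ ℤ.+0       _ _} 0<η with () ← ℚ.positive 0<η
-- As η = (m + 1)/(d + 1), the witness times η is (e + 1)(m + 1); `suc e` in place of `e` keeps the
-- witness positive.
archimedean e {η@(mkℚ ℤ.+[1+ m ] d _)} 0<η = suc e * suc d , s≤s z≤n , (begin
    natℚ e                                  ≤⟨ natℚ-mono (≤-trans (n≤1+n e) (m≤m*n (suc e) (suc m))) ⟩
    natℚ (suc e * suc m)                    ≡⟨ natℚ-* (suc e) (suc m) ⟩
    natℚ (suc e) ℚ.* natℚ (suc m)           ≡⟨ cong (natℚ (suc e) ℚ.*_) (sym den-η) ⟩
    natℚ (suc e) ℚ.* (natℚ (suc d) ℚ.* η)   ≡⟨ sym (ℚ.*-assoc (natℚ (suc e)) (natℚ (suc d)) η) ⟩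
    natℚ (suc e) ℚ.* natℚ (suc d) ℚ.* η     ≡⟨ cong (ℚ._* η) (sym (natℚ-* (suc e) (suc d))) ⟩
    natℚ (suc e * suc d) ℚ.* η              ∎)
  where
  open ℚ.≤-Reasoning
  den-η : natℚ (suc d) ℚ.* η ≡ natℚ (suc m)
  den-η = subst (λ q → natℚ (suc d) ℚ.* q ≡ natℚ (suc m)) (ℚ.↥p/↧p≡p η) (natℚ-*-/ (suc m) (suc d))

seq-· : ∀ n x m → seq (n · x) m ≡ natℚ n ℚ.* seq x m
seq-· zero    x m = sym (ℚ.*-zeroˡ (seq x m))
seq-· (suc n) x m = begin
  seq x m ℚ.+ seq (n · x) m                  ≡⟨ cong₂ ℚ._+_ (sym (ℚ.*-identityˡ (seq x m))) (seq-· n x m) ⟩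
  1ℚ ℚ.* seq x m ℚ.+ natℚ n ℚ.* seq x m      ≡⟨ sym (ℚ.*-distribʳ-+ (seq x m) 1ℚ (natℚ n)) ⟩
  (1ℚ ℚ.+ natℚ n) ℚ.* seq x m                ≡⟨ cong (ℚ._* seq x m) (sym (natℚ-+ 1 n)) ⟩
  natℚ (suc n) ℚ.* seq x m                   ∎
  where open ≡-Reasoning

-- Since `n` is at least 1, the error ε is at most n times ε and survives the division by `n`.
·-cancel-≤ : ∀ {n} → 0 < n → ∀ x c μ → natℚ c ℚ.≤ natℚ n ℚ.* μ → n · x ≤ᴿ fromℕ c → x ≤ᴿ fromℚ μ
·-cancel-≤ {n} 0<n x c μ c≤ nx≤c ε 0<ε with nx≤c ε 0<ε
... | N , bound = N , λ m N≤m → ℚ.*-cancelˡ-≤-pos (natℚ n) ⦃ natℚ-pos 0<n ⦄ (begin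
    natℚ n ℚ.* seq x m            ≡⟨ sym (seq-· n x m) ⟩
    seq (n · x) m                 ≤⟨ bound m N≤m ⟩
    natℚ c ℚ.+ ε                  ≤⟨ ℚ.+-mono-≤ c≤ (≤-natℚ-* 0<n (ℚ.<⇒≤ 0<ε)) ⟩
    natℚ n ℚ.* μ ℚ.+ natℚ n ℚ.* ε ≡⟨ sym (ℚ.*-distribˡ-+ (natℚ n) μ ε) ⟩
    natℚ n ℚ.* (μ ℚ.+ ε)          ∎)
  where open ℚ.≤-Reasoning

0<½ε : ∀ {ε} → 0ℚ ℚ.< ε → 0ℚ ℚ.< ½ ℚ.* ε
0<½ε {ε} 0<ε = subst (ℚ._< ½ ℚ.* ε) (ℚ.*-zeroʳ ½) (ℚ.*-monoʳ-<-pos ½ 0<ε)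

½ε+½ε : ∀ ε → ½ ℚ.* ε ℚ.+ ½ ℚ.* ε ≡ ε
½ε+½ε ε = trans (sym (ℚ.*-distribʳ-+ ε ½ ½)) (ℚ.*-identityˡ ε)

-- If `δ` is eventually at least ε, one half of ε absorbs the error in the bound on `x` and the
-- other half remains as η.
difference-bound : ∀ {x μ δ} → x ≤ᴿ fromℚ μ → 0ᴿ <ᴿ δ →
  ∃[ η ] (0ℚ ℚ.< η × ∃[ N ] (∀ m → N ≤ m → seq (x -ᴿ δ) m ℚ.≤ μ ℚ.- η))
difference-bound {x} {μ} {δ} x≤μ (ε , 0<ε , N₁ , δ≥) with x≤μ (½ ℚ.* ε) (0<½ε 0<ε)
... | N₂ , x≤ = ½ ℚ.* ε , 0<½ε 0<ε , N₁ ⊔ N₂ , λ m N≤m → begin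
    seq x m ℚ.- seq δ m
      ≤⟨ ℚ.+-mono-≤ (x≤ m (m⊔n≤o⇒n≤o N₁ N₂ N≤m))
          (ℚ.neg-antimono-≤ (δ≥ m (m⊔n≤o⇒m≤o N₁ N₂ N≤m))) ⟩
    (μ ℚ.+ ½ ℚ.* ε) ℚ.- (0ℚ ℚ.+ ε)
      ≡⟨ cong (λ t → (μ ℚ.+ ½ ℚ.* ε) ℚ.- t) (trans (ℚ.+-identityˡ ε) (sym (½ε+½ε ε))) ⟩
    (μ ℚ.+ ½ ℚ.* ε) ℚ.- (½ ℚ.* ε ℚ.+ ½ ℚ.* ε)
      ≡⟨ solve 2 (λ a b → (a :+ b) :- (b :+ b) := a :- b) refl μ (½ ℚ.* ε) ⟩
    μ ℚ.- ½ ℚ.* ε                             ∎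
  where
  open ℚ.≤-Reasoning
  open +-*-Solver

·-≤-fromℕ : ∀ n x c q → ∃[ N ] (∀ m → N ≤ m → seq x m ℚ.≤ q) →
  natℚ n ℚ.* q ℚ.≤ natℚ c → n · x ≤ᴿ fromℕ c
·-≤-fromℕ n x c q (N , x≤q) nq≤c ε 0<ε = N , λ m N≤m → begin
    seq (n · x) m      ≡⟨ seq-· n x m ⟩
    natℚ n ℚ.* seq x m ≤⟨ ℚ.*-monoˡ-≤-nonNeg (natℚ n) ⦃ natℚ-nonNeg n ⦄ (x≤q m N≤m) ⟩
    natℚ n ℚ.* q       ≤⟨ nq≤c ⟩
    natℚ c             ≡⟨ sym (ℚ.+-identityʳ (natℚ c)) ⟩
    natℚ c ℚ.+ 0ℚ      ≤⟨ ℚ.+-monoʳ-≤ (natℚ c) (ℚ.<⇒≤ 0<ε) ⟩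
    natℚ c ℚ.+ ε       ∎
  where open ℚ.≤-Reasoning

-- Dividing the count by t S N leaves the error t μ n / N ≤ η n.
absorb-error : ∀ N S t n c μ η .{{_ : ℚ.Positive N}} .{{_ : ℚ.Positive (t ℚ.* S)}} .{{_ : ℚ.NonNegative n}} →
  N ℚ.* ((t ℚ.* S ℚ.* μ) ℚ.* n) ℚ.≤ N ℚ.* (S ℚ.* (t ℚ.* c)) ℚ.+ (t ℚ.* S ℚ.* μ) ℚ.* (t ℚ.* n) →
  t ℚ.* μ ℚ.≤ N ℚ.* η → n ℚ.* (μ ℚ.- η) ℚ.≤ c
absorb-error N S t n c μ η le tμ≤ = ℚ.*-cancelˡ-≤-pos N (begin
    N ℚ.* (n ℚ.* (μ ℚ.- η))
      ≡⟨ solve 4 (λ N n μ η → N :* (n :* (μ :- η)) := N :* μ :* n :- N :* η :* n) refl N n μ η ⟩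
    N ℚ.* μ ℚ.* n ℚ.- N ℚ.* η ℚ.* n
      ≤⟨ ℚ.+-monoˡ-≤ (ℚ.- (N ℚ.* η ℚ.* n)) (ℚ.*-cancelˡ-≤-pos (t ℚ.* S) le′) ⟩
    N ℚ.* c ℚ.+ t ℚ.* μ ℚ.* n ℚ.- N ℚ.* η ℚ.* n
      ≤⟨ ℚ.+-monoˡ-≤ (ℚ.- (N ℚ.* η ℚ.* n)) (ℚ.+-monoʳ-≤ (N ℚ.* c) (ℚ.*-monoʳ-≤-nonNeg n tμ≤)) ⟩
    N ℚ.* c ℚ.+ N ℚ.* η ℚ.* n ℚ.- N ℚ.* η ℚ.* n
      ≡⟨ solve 2 (λ a b → a :+ b :- b := a) refl (N ℚ.* c) (N ℚ.* η ℚ.* n) ⟩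
    N ℚ.* c ∎)
  where
  open ℚ.≤-Reasoning
  open +-*-Solver
  le′ : t ℚ.* S ℚ.* (N ℚ.* μ ℚ.* n) ℚ.≤ t ℚ.* S ℚ.* (N ℚ.* c ℚ.+ t ℚ.* μ ℚ.* n)
  le′ = subst₂ ℚ._≤_
    (solve 5 (λ N S t n μ → N :* ((t :* S :* μ) :* n) := t :* S :* (N :* μ :* n)) refl N S t n μ)
    (solve 6 (λ N S t n c μ →
        N :* (S :* (t :* c)) :+ (t :* S :* μ) :* (t :* n) := t :* S :* (N :* c :+ t :* μ :* n))
      refl N S t n c μ)
    le

-- The critical density

subset-of-size : ∀ s l → ∃[ X ] (card {s + l} X ≡ s)
subset-of-size zero    l = ∅ , ∣⊥∣≡0 l
subset-of-size (suc s) l = let X , eq = subset-of-size s l in inside Vec.∷ X , cong suc eq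

module Density {k : ℕ} (P : Parameters k) where

  open Parameters P

  private
    s+l≢0 : NonZero (s + l)
    s+l≢0 = >-nonZero s+l>0

    2[s+l]≢0 : NonZero (2 * (s + l))
    2[s+l]≢0 = >-nonZero (*-mono-≤ {1} {2} (s≤s z≤n) s+l>0)

  -- Critical number of edges per vertex; the 2 undoes the double count in `E`.
  density : ℚ
  density = (ℤ.+ E ℚ./ (2 * (s + l))) ⦃ 2[s+l]≢0 ⦄

  natℚ-E : natℚ 2 ℚ.* natℚ (s + l) ℚ.* density ≡ natℚ E
  natℚ-E = trans (cong (ℚ._* density) (sym (natℚ-* 2 (s + l)))) (natℚ-*-/ E (2 * (s + l)) ⦃ 2[s+l]≢0 ⦄)

  module _ (X : Subset (s + l)) (card-X : card X ≡ s) where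

    -- For red, the tangent at `i` touches the count at j = `i` and j = `suc i`, the two kinds of
    -- copies in `balance`, so it gives exactly `E`. For blue, the chord gives (k - 1)(n - s) with n
    -- = s + l, which is `E` again.
    bipartite-bound : ∀ (F : Factor k (s + l)) d → 2 * edgesOfColour (bipartite X red) d F ≤ E
    bipartite-bound F d = by-colour d
      where
      w : ℕ
      w = length (cliques F)
      w≡ : w ≡ u + v
      w≡ = *-cancelʳ-≡ w (u + v) k ⦃ >-nonZero k>0 ⦄ (trans (number F) s+l)
      by-colour : ∀ d → 2 * edgesOfColour (bipartite X red) d F ≤ E
      by-colour red = linear {x = 2 * C + 2 * suc i * s} {y = (u + v) * (i * suc i) + 2 * suc (i + r) * s}
          (subst₂ _≤_ (cong (λ x → 2 * C + 2 * suc i * x) card-X)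
                      (cong₂ _+_ (cong (_* (i * suc i)) w≡) (cong₂ (λ x y → 2 * x * y) (sym k≡) card-X))
                      (Bipartite.edgesOfColour-tangent X red F i))
          (trans (ring i r u v C) (cong (λ e → e + (2 * C + 2 * suc i * s)) balance))
        where
        C = edgesOfColour (bipartite X red) red F
        ring : ∀ i r u v C → 2 * C + ((u + v) * (i * suc i) + 2 * suc (i + r) * (u * i + v * suc i))
             ≡ u * (i * i + 2 * i * r + i) + v * (i * i + i + 2 * i * r + 2 * r) + (2 * C + 2 * suc i * (u * i + v * suc i))
        ring = solve-∀
      by-colour blue = linear {x = 2 * C + (s + l) + suc (i + r) * s} {y = (s + l) * suc (i + r) + s}
          (subst₂ _≤_ (cong₂ (λ x y → 2 * C + x + y) (number F) (cong₂ _*_ (sym k≡) card-X))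
                      (cong₂ _+_ (trans (sym (*-assoc w k k)) (cong₂ _*_ (number F) (sym k≡))) card-X)
                      (Bipartite.edgesOfColour-outside X red F))
          (ring i r s l C)
        where
        C = edgesOfColour (bipartite X red) blue F
        ring : ∀ i r s l C → 2 * C + ((s + l) * suc (i + r) + s) ≡ l * (i + r) + (2 * C + (s + l) + suc (i + r) * s)
        ring = solve-∀

  admissible-bound : ∀ x → Admissible k x → x ≤ᴿ fromℚ density
  admissible-bound x adm =
    let X , card-X = subset-of-size s l
        ρ = (ℤ.+ s ℚ./ (s + l)) ⦃ s+l≢0 ⦄
        ρ-def = natℚ-*-/ s (s + l) ⦃ s+l≢0 ⦄
        F , d , nx≤ = adm (s + l) (divides (u + v) s+l) ρ (ρ-nonNeg ρ ρ-def) (ρ≤1 ρ ρ-def) X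
                          (trans (cong natℚ card-X) (trans (sym ρ-def) (ℚ.*-comm (natℚ (s + l)) ρ))) red
    in ·-cancel-≤ s+l>0 x (edgesOfColour (bipartite X red) d F) density
       (halve (edgesOfColour (bipartite X red) d F) (bipartite-bound X card-X F d)) nx≤
    where
    open ℚ.≤-Reasoning
    ρ-nonNeg : ∀ ρ → natℚ (s + l) ℚ.* ρ ≡ natℚ s → 0ℚ ℚ.≤ ρ
    ρ-nonNeg ρ eq = ℚ.*-cancelˡ-≤-pos (natℚ (s + l)) ⦃ natℚ-pos s+l>0 ⦄ (begin
      natℚ (s + l) ℚ.* 0ℚ ≡⟨ ℚ.*-zeroʳ (natℚ (s + l)) ⟩
      natℚ 0              ≤⟨ natℚ-mono {0} {s} z≤n ⟩
      natℚ s              ≡⟨ sym eq ⟩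
      natℚ (s + l) ℚ.* ρ  ∎)
    ρ≤1 : ∀ ρ → natℚ (s + l) ℚ.* ρ ≡ natℚ s → ρ ℚ.≤ 1ℚ
    ρ≤1 ρ eq = ℚ.*-cancelˡ-≤-pos (natℚ (s + l)) ⦃ natℚ-pos s+l>0 ⦄ (begin
      natℚ (s + l) ℚ.* ρ  ≡⟨ eq ⟩
      natℚ s              ≤⟨ natℚ-mono {s} {s + l} (m≤m+n s l) ⟩
      natℚ (s + l)        ≡⟨ sym (ℚ.*-identityʳ (natℚ (s + l))) ⟩
      natℚ (s + l) ℚ.* 1ℚ ∎)
    halve : ∀ C → 2 * C ≤ E → natℚ C ℚ.≤ natℚ (s + l) ℚ.* density
    halve C 2C≤E = ℚ.*-cancelˡ-≤-pos (natℚ 2) ⦃ natℚ-pos {2} (s≤s z≤n) ⦄ (begin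
      natℚ 2 ℚ.* natℚ C                      ≡⟨ sym (natℚ-* 2 C) ⟩
      natℚ (2 * C)                           ≤⟨ natℚ-mono {2 * C} {E} 2C≤E ⟩
      natℚ E                                 ≡⟨ sym natℚ-E ⟩
      natℚ 2 ℚ.* natℚ (s + l) ℚ.* density    ≡⟨ ℚ.*-assoc (natℚ 2) (natℚ (s + l)) density ⟩
      natℚ 2 ℚ.* (natℚ (s + l) ℚ.* density)  ∎)

  -- A crude bound from `s + l` being at least 1. It lets `archimedean` be applied to the natural
  -- number `E` to control the error term of `absorb-error`.
  2density≤E : natℚ 2 ℚ.* density ℚ.≤ natℚ E
  2density≤E = begin
      natℚ 2 ℚ.* density                     ≤⟨ ≤-natℚ-* s+l>0 2density≥0 ⟩
      natℚ (s + l) ℚ.* (natℚ 2 ℚ.* density)  ≡⟨ swap ⟩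
      natℚ E                                 ∎
    where
    open ℚ.≤-Reasoning
    swap : natℚ (s + l) ℚ.* (natℚ 2 ℚ.* density) ≡ natℚ E
    swap = trans (sym (ℚ.*-assoc (natℚ (s + l)) (natℚ 2) density))
      (trans (cong (ℚ._* density) (ℚ.*-comm (natℚ (s + l)) (natℚ 2))) natℚ-E)
    2density≥0 : 0ℚ ℚ.≤ natℚ 2 ℚ.* density
    2density≥0 = ℚ.*-cancelˡ-≤-pos (natℚ (s + l)) ⦃ natℚ-pos s+l>0 ⦄
      (subst₂ ℚ._≤_ (sym (ℚ.*-zeroʳ (natℚ (s + l)))) (sym swap) (natℚ-mono {0} {E} z≤n))

  count-bound : ∀ N n C η → 0 < N → natℚ E ℚ.≤ natℚ N ℚ.* η →
    N * (E * n) ≤ N * ((s + l) * (2 * C)) + E * (2 * n) →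
    natℚ n ℚ.* (density ℚ.- η) ℚ.≤ natℚ C
  count-bound N n C η 0<N E≤Nη le =
    absorb-error (natℚ N) (natℚ (s + l)) (natℚ 2) (natℚ n) (natℚ C) density η
      ⦃ natℚ-pos 0<N ⦄
      ⦃ subst ℚ.Positive (natℚ-* 2 (s + l)) (natℚ-pos (*-mono-≤ {1} {2} (s≤s z≤n) s+l>0)) ⦄
      ⦃ natℚ-nonNeg n ⦄
      (subst₂ ℚ._≤_ lhs rhs (natℚ-mono {N * (E * n)} le))
      (ℚ.≤-trans 2density≤E E≤Nη)
    where
    lhs : natℚ (N * (E * n)) ≡ natℚ N ℚ.* ((natℚ 2 ℚ.* natℚ (s + l) ℚ.* density) ℚ.* natℚ n)
    lhs = trans (natℚ-* N (E * n)) (cong (natℚ N ℚ.*_) (trans (natℚ-* E n) (cong (ℚ._* natℚ n) (sym natℚ-E))))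
    rhs : natℚ (N * ((s + l) * (2 * C)) + E * (2 * n)) ≡
          natℚ N ℚ.* (natℚ (s + l) ℚ.* (natℚ 2 ℚ.* natℚ C)) ℚ.+
          (natℚ 2 ℚ.* natℚ (s + l) ℚ.* density) ℚ.* (natℚ 2 ℚ.* natℚ n)
    rhs = trans (natℚ-+ (N * ((s + l) * (2 * C))) (E * (2 * n))) (cong₂ ℚ._+_
      (trans (natℚ-* N ((s + l) * (2 * C))) (cong (natℚ N ℚ.*_)
        (trans (natℚ-* (s + l) (2 * C)) (cong (natℚ (s + l) ℚ.*_) (natℚ-* 2 C)))))
      (trans (natℚ-* E (2 * n)) (cong₂ ℚ._*_ (sym natℚ-E) (natℚ-* 2 n))))

theorem1p4 : ∀ (k : ℕ) → 2 ≤ k → ∀ (λₖ : ℝ) → IsLambda k λₖ →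
    ∀ (δ : ℝ) → 0ᴿ <ᴿ δ →
    ∃[ n₀ ] (∀ (n : ℕ) → n₀ ≤ n → k ∣ n →
    ∀ (c : Colouring n) → HasFactor k c (n · (λₖ -ᴿ δ)))
theorem1p4 k 2≤k λₖ isλ δ 0<δ =
  let P = parameters k 2≤k
      open Parameters P using (E)
      open Density P
      -- As `density` bounds every admissible value, the supremum is at most `density`. It thus
      -- suffices to reach `density - η` in every colouring, with η the margin that subtracting `δ`
      -- leaves.
      η , 0<η , near = difference-bound {λₖ} {density} {δ}
        (IsSupremum.least isλ (fromℚ density) admissible-bound) 0<δ
      N , 0<N , E≤Nη = archimedean E 0<η
      n₀ , factors   = many-edges P N 0<N
  in n₀ , λ n n₀≤n k∣n c →
    let F , a , many = factors n n₀≤n k∣n c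
    in F , a , ·-≤-fromℕ n (λₖ -ᴿ δ) (edgesOfColour c a F) (density ℚ.- η) near
       (count-bound N n (edgesOfColour c a F) η 0<N E≤Nη many)
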